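{- Let $n$ be an even positive integer and $G$ a connected graph on $n$ vertices with minimum degree $\delta(G)\geqslant 2$. Then: (i) if $n=6$ and $|E(G)|\geqslant 10$, then $G$ is $1$-excludable unless $G\cong K_2\vee(K_2\cup 2K_1)$; (ii) if $n=8$ and $|E(G)|\geqslant 19$, then $G$ is $1$-excludable unless $G\cong K_3\vee(K_2\cup 3K_1)$; (iii) if $n\geqslant 10$ and $|E(G)|\geqslant\binom{n-2}{2}+3$, then $G$ is $1$-excludable unless $G\cong K_4\vee(K_2\cup 4K_1)$ or $G\cong K_1\vee(K_2\cup K_{n-3})$.
   Context: All graphs are finite, simple and undirected. A perfect matching is a set of pairwise vertex-disjoint edges covering all vertices. A graph $G$ is $1$-excludable if for every edge $e$ of $G$ there is a perfect matching of $G$ not containing $e$. $K_r$ is the complete graph on $r$ vertices; $tK_1$ is the edgeless graph on $t$ vertices; $G_1\cup G_2$ is the disjoint union; the join $G_1\vee G_2$ is obtained from $G_1\cup G_2$ by adding all edges between $V(G_1)$ and $V(G_2)$. -}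

module Defs where

open import Data.Nat using (ℕ; zero; suc; _+_; _<ᵇ_)
open import Data.Bool using (Bool; true; false; not; _∧_)
open import Data.Fin using (Fin; toℕ; splitAt; _≟_)
open import Data.Fin.Properties using ()
open import Data.Sum using (_⊎_; inj₁; inj₂)
open import Data.Product using (Σ; _×_; _,_)
open import Data.List using (List; []; _∷_; map; concatMap; allFin)
open import Relation.Nullary using (¬_; yes; no; does)
open import Relation.Binary.PropositionalEquality using (_≡_; refl; sym; _≢_)
open import Function.Bundles using (_↔_; Inverse)
open import Data.Empty using (⊥-elim)

record Graph (n : ℕ) : Set where
  field
    adj     : Fin n → Fin n → Bool
    adj-sym : ∀ i j → adj i j ≡ adj j i
    adj-irr : ∀ i → adj i i ≡ false
open Graph public

countTrue : List Bool → ℕ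
countTrue []           = 0
countTrue (true ∷ bs)  = suc (countTrue bs)
countTrue (false ∷ bs) = countTrue bs

degree : ∀ {n} → Graph n → Fin n → ℕ
degree {n} G i = countTrue (map (adj G i) (allFin n))

numEdges : ∀ {n} → Graph n → ℕ
numEdges {n} G =
  countTrue (concatMap (λ i → map (λ j → adj G i j ∧ (toℕ i <ᵇ toℕ j)) (allFin n)) (allFin n))

MinDegreeAtLeast : ∀ {n} → ℕ → Graph n → Set
MinDegreeAtLeast k G = ∀ i → k Data.Nat.≤ degree G i

data Reach {n} (G : Graph n) : Fin n → Fin n → Set where
  here : ∀ {i} → Reach G i i
  step : ∀ {i j k} → adj G i j ≡ true → Reach G j k → Reach G i k

Connected : ∀ {n} → Graph n → Set
Connected {n} G = ∀ (i j : Fin n) → Reach G i j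

-- A perfect matching, given by its partner map: every vertex i is matched
-- to exactly one vertex partner i, via an edge of G (the edge set of the
-- matching is { {i , partner i} }; pairwise disjointness and covering
-- are exactly the involution + fixed-point-free conditions).
record PerfectMatching {n} (G : Graph n) : Set where
  field
    partner       : Fin n → Fin n
    partner-edge  : ∀ i → adj G i (partner i) ≡ true
    partner-invol : ∀ i → partner (partner i) ≡ i
open PerfectMatching public

-- the edge {u , v} lies in the matching M  iff  partner M u ≡ v
-- 1-excludable: every edge is avoided by some perfect matching
OneExcludable : ∀ {n} → Graph n → Set
OneExcludable {n} G =
  ∀ (u v : Fin n) → adj G u v ≡ true →
    Σ (PerfectMatching G) λ M → partner M u ≢ v

-- isomorphism (between graphs on possibly differently-written vertex counts)
_≅_ : ∀ {n m} → Graph n → Graph m → Set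
_≅_ {n} {m} G H =
  Σ (Fin n ↔ Fin m) λ f → ∀ i j → adj H (Inverse.to f i) (Inverse.to f j) ≡ adj G i j

complete : (r : ℕ) → Graph r
complete r = record { adj = λ i j → not (does (i ≟ j)) ; adj-sym = s ; adj-irr = ir }
  where
  s : ∀ i j → not (does (i ≟ j)) ≡ not (does (j ≟ i))
  s i j with i ≟ j | j ≟ i
  ... | yes _ | yes _ = refl
  ... | no _  | no _  = refl
  ... | yes p | no q  = ⊥-elim (q (sym p))
  ... | no q  | yes p = ⊥-elim (q (sym p))
  ir : ∀ i → not (does (i ≟ i)) ≡ false
  ir i with i ≟ i
  ... | yes _ = refl
  ... | no q  = ⊥-elim (q refl)

edgeless : (t : ℕ) → Graph t
edgeless t = record { adj = λ _ _ → false ; adj-sym = λ _ _ → refl ; adj-irr = λ _ → refl }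

sumAdj : ∀ {a b} → Bool → Graph a → Graph b → Fin a ⊎ Fin b → Fin a ⊎ Fin b → Bool
sumAdj c G H (inj₁ x) (inj₁ y) = adj G x y
sumAdj c G H (inj₂ x) (inj₂ y) = adj H x y
sumAdj c G H (inj₁ x) (inj₂ y) = c
sumAdj c G H (inj₂ x) (inj₁ y) = c

sumAdj-sym : ∀ {a b} c (G : Graph a) (H : Graph b) x y → sumAdj c G H x y ≡ sumAdj c G H y x
sumAdj-sym c G H (inj₁ x) (inj₁ y) = adj-sym G x y
sumAdj-sym c G H (inj₂ x) (inj₂ y) = adj-sym H x y
sumAdj-sym c G H (inj₁ x) (inj₂ y) = refl
sumAdj-sym c G H (inj₂ x) (inj₁ y) = refl

sumAdj-irr : ∀ {a b} c (G : Graph a) (H : Graph b) x → sumAdj c G H x x ≡ false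
sumAdj-irr c G H (inj₁ x) = adj-irr G x
sumAdj-irr c G H (inj₂ x) = adj-irr H x

sumGraph : ∀ {a b} → Bool → Graph a → Graph b → Graph (a + b)
sumGraph {a} c G H = record
  { adj     = λ i j → sumAdj c G H (splitAt a i) (splitAt a j)
  ; adj-sym = λ i j → sumAdj-sym c G H (splitAt a i) (splitAt a j)
  ; adj-irr = λ i → sumAdj-irr c G H (splitAt a i) }

_∪ᴳ_ : ∀ {a b} → Graph a → Graph b → Graph (a + b)
G ∪ᴳ H = sumGraph false G H

_∨ᴳ_ : ∀ {a b} → Graph a → Graph b → Graph (a + b)
G ∨ᴳ H = sumGraph true G H

infixr 6 _∨ᴳ_
infixr 7 _∪ᴳ_

{-# OPTIONS --safe #-}
-- Delete e = uv.  If the rest G′ has no perfect matching, a pairing of the vertices with as few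
-- non-edges as possible has exactly one non-edge ab: with two of them, either a switch improves the
-- pairing or G′ has too many non-edges.  Let m be the number of remaining (matching) edges, so that
-- n = 2m + 2.  Since no path of length 3 augments ab, a matching edge meeting the neighbourhoods of
-- both a and b has a common neighbour at one end and no neighbour at the other.  With T such edges,
-- and P (Q) the number of further neighbours of a (b), we have deg a = T + P and deg b = T + Q, and
-- the non-edges forced by the absence of augmenting paths of length 3 and 5 give
--   1 + 4m + T(T-1)/2 + T(P + Q) + PQ ≤ #non-edges + deg a + deg b.
-- Augmenting paths of length 7 force two more non-edges if T ≥ 2 and some matching edge misses both
-- neighbourhoods.  If deg a, deg b ≥ 2, the edge bound now yields T = m ≤ 4 with equality
-- everywhere, hence G′ = K_m ∨ (m + 2)K_1.  If deg b = 1, the minimum degree of G makes b an end of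
-- e; removing b and its neighbour leaves a graph in which the same inequality forces an isolated
-- vertex (the other end of e) and a clique.
module Submission where

open import Defs hiding (here; step)
open import Data.Bool using (Bool; true; false; not; _∧_; _∨_)
open import Data.Bool.Properties using (T-≡; ∧-comm; ∨-comm; ∧-zeroʳ; ∧-identityʳ)
import Data.Bool.Properties as Bool
open import Data.Empty using (⊥; ⊥-elim)
open import Data.Fin as Fin using (Fin; toℕ; splitAt)
open import Data.Fin.Properties using (all?) renaming (any? to Fin-any?)
open import Data.List using (List; []; _∷_; _++_; map; length; allFin; tabulate; concatMap)
open import Data.List.Membership.Propositional using (_∈_)
open import Data.List.Membership.Propositional.Properties using (∈-allFin; ∈-++⁻)
open import Data.List.Properties using (map-++; length-map; map-∘; map-tabulate; length-tabulate)
open import Data.List.Relation.Binary.Permutation.Propositional using (_↭_; refl; prep; swap; trans; ↭-sym; ↭-reflexive; ↭⇒↭ₛ)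
open import Data.List.Relation.Binary.Permutation.Propositional.Properties using (map⁺; ++⁺; ++⁺ˡ; shift; All-resp-↭; ∈-resp-↭; ↭-length; ++-comm)
import Data.List.Relation.Binary.Permutation.Setoid.Properties as SetoidPerm
open import Data.List.Relation.Unary.All as All using (All; []; _∷_)
import Data.List.Relation.Unary.All.Properties as AllP
open import Data.List.Relation.Unary.AllPairs using (AllPairs; []; _∷_) renaming (map to AllPairs-map)
open import Data.List.Relation.Unary.Any using (Any; here; there; any?) renaming (map to Any-map)
open import Data.List.Relation.Unary.Unique.Propositional using (Unique)
open import Data.List.Relation.Unary.Unique.Propositional.Properties using (allFin⁺)
open import Data.Nat using (ℕ; zero; suc; _+_; _*_; _∸_; _≤_; _<_; z≤n; s≤s; _≤ᵇ_; _<ᵇ_; _≤?_)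
open import Data.Nat.Combinatorics using (_C_; nCk+nC[k+1]≡[n+1]C[k+1]; nC1≡n)
open import Data.Nat.ListAction using (sum)
open import Data.Nat.ListAction.Properties using (sum-↭; sum-++)
open import Data.Nat.Properties
open import Data.Nat.Tactic.RingSolver using (solve-∀)
open import Data.Product using (Σ; ∃; ∃₂; _×_; _,_; proj₁; proj₂)
open import Data.Sum using (_⊎_; inj₁; inj₂)
open import Data.Vec as Vec using (Vec)
open import Data.Vec.Membership.Propositional.Properties using (∈-toList⁺; ∈-toList⁻; ∈-lookup)
open import Data.Vec.Properties using (lookup∘tabulate; lookup-splitAt; toList-++; toList∘fromList)
import Data.Vec.Relation.Unary.Any as VecAny
open import Data.Vec.Relation.Unary.Any.Properties using (lookup-index)
open import Function using (_∘_; _on_)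
open import Function.Bundles using (mk↔ₛ′; module Equivalence)
open import Relation.Binary.Definitions using (Symmetric)
open import Relation.Binary.PropositionalEquality as ≡ using (_≡_; _≢_; _≗_; refl; sym; cong; cong₂; subst; subst₂; setoid; resp₂; module ≡-Reasoning)
open import Relation.Nullary using (¬_; Dec; yes; no; does)
open import Relation.Nullary.Decidable using (dec-true; dec-false; map′; _×-dec_)

-- Linear arithmetic, sums over lists and indicators.

-- Reduces a linear inequality to a ring identity that `solve-∀` can check; `d` is the slack given
-- away on the way from `l ≤ r`.
≤-by : ∀ {l r a b} d → l ≤ r → a + r + d ≡ l + b → a ≤ b
≤-by {l} {r} {a} {b} d l≤r eq = +-cancelʳ-≤ r a b (begin
  a + r     ≤⟨ m≤m+n (a + r) d ⟩
  a + r + d ≡⟨ eq ⟩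
  l + b     ≤⟨ +-monoˡ-≤ b l≤r ⟩
  r + b     ≡⟨ +-comm r b ⟩
  b + r     ∎)
  where open ≤-Reasoning

module _ {X : Set} where

  ∑ : (X → ℕ) → List X → ℕ
  ∑ g L = sum (map g L)

  ∑-↭ : ∀ (g : X → ℕ) {L L'} → L ↭ L' → ∑ g L ≡ ∑ g L'
  ∑-↭ g σ = sum-↭ (map⁺ g σ)

  ∑-++ : ∀ (g : X → ℕ) L L' → ∑ g (L ++ L') ≡ ∑ g L + ∑ g L'
  ∑-++ g L L' = ≡.trans (cong sum (map-++ g L L')) (sum-++ (map g L) (map g L'))

  ∑-+ : ∀ (g h : X → ℕ) L → ∑ (λ x → g x + h x) L ≡ ∑ g L + ∑ h L
  ∑-+ g h []      = refl
  ∑-+ g h (x ∷ L) = ≡.trans (cong (g x + h x +_) (∑-+ g h L)) (interchange (g x) (h x) (∑ g L) (∑ h L))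
    where
    interchange : ∀ a b c d → a + b + (c + d) ≡ a + c + (b + d)
    interchange = solve-∀

  ∑-const : ∀ c (L : List X) → ∑ (λ _ → c) L ≡ length L * c
  ∑-const c []      = refl
  ∑-const c (x ∷ L) = cong (c +_) (∑-const c L)

  ∑-cong : ∀ {g h : X → ℕ} {L} → All (λ x → g x ≡ h x) L → ∑ g L ≡ ∑ h L
  ∑-cong []       = refl
  ∑-cong (e ∷ es) = cong₂ _+_ e (∑-cong es)

  ∑-mono : ∀ {g h : X → ℕ} {L} → All (λ x → g x ≤ h x) L → ∑ g L ≤ ∑ h L
  ∑-mono []       = z≤n
  ∑-mono (e ∷ es) = +-mono-≤ e (∑-mono es)

  ∑≡0⇒All : ∀ (g : X → ℕ) L → ∑ g L ≡ 0 → All (λ x → g x ≡ 0) L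
  ∑≡0⇒All g []      eq = []
  ∑≡0⇒All g (x ∷ L) eq = m+n≡0⇒m≡0 (g x) eq ∷ ∑≡0⇒All g L (m+n≡0⇒n≡0 (g x) eq)

  extract : ∀ {P : X → Set} {L} → Any P L → ∃₂ λ x L' → L ↭ x ∷ L' × P x
  extract {L = x ∷ L} (here px) = x , L , refl , px
  extract {L = y ∷ L} (there i) with extract i
  ... | x , L' , σ , px = x , y ∷ L' , trans (prep y σ) (swap y x refl) , px

  ∑-pos : ∀ (g : X → ℕ) L → 1 ≤ ∑ g L → Any (λ x → 1 ≤ g x) L
  ∑-pos g (x ∷ L) le with g x in eq
  ... | zero  = there (∑-pos g L le)
  ... | suc _ = here (subst (1 ≤_) (sym eq) (s≤s z≤n))

ind : Bool → ℕ
ind true  = 1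
ind false = 0

ind≡0⇒false : ∀ {b} → ind b ≡ 0 → b ≡ false
ind≡0⇒false {false} _ = refl

ind-not≡0⇒true : ∀ {b} → ind (not b) ≡ 0 → b ≡ true
ind-not≡0⇒true {true} _ = refl

ind+ind-not : ∀ b → ind b + ind (not b) ≡ 1
ind+ind-not true  = refl
ind+ind-not false = refl

≢true⇒≡false : ∀ {b} → ¬ (b ≡ true) → b ≡ false
≢true⇒≡false {true}  h = ⊥-elim (h refl)
≢true⇒≡false {false} h = refl

-- The binomial coefficient "n choose 2", in the recursive form that fits the removal of one vertex
-- from a list.
tri : ℕ → ℕ
tri zero    = 0
tri (suc n) = n + tri n

-- Non-edges, pairings and matchings in lists of vertices.

module Matchings {V : Set} (A : V → V → Bool) (A-sym : ∀ x y → A x y ≡ A y x) where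

  gap : V → V → ℕ
  gap x y = ind (not (A x y))

  gap-sym : ∀ x y → gap x y ≡ gap y x
  gap-sym x y = cong (λ b → ind (not b)) (A-sym x y)

  deg : V → List V → ℕ
  deg x = ∑ (λ y → ind (A x y))

  -- On a list without repetitions this is the number of non-edges of the induced subgraph.
  missing : List V → ℕ
  missing []      = 0
  missing (x ∷ L) = ∑ (gap x) L + missing L

  between : List V → List V → ℕ
  between X Y = ∑ (λ x → ∑ (gap x) Y) X

  deg+gaps : ∀ x L → deg x L + ∑ (gap x) L ≡ length L
  deg+gaps x L = begin
    deg x L + ∑ (gap x) L                    ≡⟨ ∑-+ (λ y → ind (A x y)) (gap x) L ⟨
    ∑ (λ y → ind (A x y) + gap x y) L        ≡⟨ ∑-cong (All.universal (λ y → ind+ind-not (A x y)) L) ⟩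
    ∑ (λ _ → 1) L                            ≡⟨ ∑-const 1 L ⟩
    length L * 1                             ≡⟨ *-identityʳ (length L) ⟩
    length L                                 ∎
    where open ≡-Reasoning

  missing-++ : ∀ X Y → missing (X ++ Y) ≡ missing X + (between X Y + missing Y)
  missing-++ []      Y = refl
  missing-++ (x ∷ X) Y = ≡.trans (cong₂ _+_ (∑-++ (gap x) X Y) (missing-++ X Y))
    (rearrange (∑ (gap x) X) (∑ (gap x) Y) (missing X) (between X Y) (missing Y))
    where
    rearrange : ∀ a b c d e → a + b + (c + (d + e)) ≡ a + c + (b + d + e)
    rearrange = solve-∀

  missing-↭ : ∀ {L L'} → L ↭ L' → missing L ≡ missing L'
  missing-↭ refl         = refl
  missing-↭ (prep x σ)   = cong₂ _+_ (∑-↭ (gap x) σ) (missing-↭ σ)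
  missing-↭ (trans σ σ') = ≡.trans (missing-↭ σ) (missing-↭ σ')
  missing-↭ (swap {xs} {ys} x y σ)
    rewrite ∑-↭ (gap x) σ | ∑-↭ (gap y) σ | missing-↭ σ | gap-sym x y =
    rearrange (gap y x) (∑ (gap x) ys) (∑ (gap y) ys) (missing ys)
    where
    rearrange : ∀ a b c d → a + b + (c + d) ≡ a + c + (b + d)
    rearrange = solve-∀

  Pair : Set
  Pair = V × V

  flip : Pair → Pair
  flip (x , y) = (y , x)

  flat : List Pair → List V
  flat []            = []
  flat ((x , y) ∷ M) = x ∷ y ∷ flat M

  flat-++ : ∀ M N → flat (M ++ N) ≡ flat M ++ flat N
  flat-++ []            N = refl
  flat-++ ((x , y) ∷ M) N = cong (λ L → x ∷ y ∷ L) (flat-++ M N)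

  flat-↭ : ∀ {M N} → M ↭ N → flat M ↭ flat N
  flat-↭ refl         = refl
  flat-↭ (prep (x , y) σ) = prep x (prep y (flat-↭ σ))
  flat-↭ (trans σ τ)  = trans (flat-↭ σ) (flat-↭ τ)
  flat-↭ (swap {xs} {ys} (x , y) (z , w) σ) =
    trans (++⁺ˡ (x ∷ y ∷ z ∷ w ∷ []) (flat-↭ σ)) (++⁺ (++-comm (x ∷ y ∷ []) (z ∷ w ∷ [])) (refl {xs = flat ys}))

  flat-length : ∀ M → length (flat M) ≡ 2 * length M
  flat-length []            = refl
  flat-length ((x , y) ∷ M) = ≡.trans (cong (λ k → suc (suc k)) (flat-length M)) (2*suc (length M))
    where
    2*suc : ∀ k → suc (suc (2 * k)) ≡ 2 * suc k
    2*suc = solve-∀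

  ∑-flat : ∀ (g : V → ℕ) M → ∑ g (flat M) ≡ ∑ (λ e → g (proj₁ e) + g (proj₂ e)) M
  ∑-flat g []            = refl
  ∑-flat g ((x , y) ∷ M) = ≡.trans (cong (λ s → g x + (g y + s)) (∑-flat g M)) (sym (+-assoc (g x) (g y) _))

  across : Pair → Pair → ℕ
  across (x , y) (z , w) = (gap x z + gap x w) + (gap y z + gap y w)

  gap′ : Pair → ℕ
  gap′ (x , y) = gap x y

  missing-flat : ∀ e M → missing (flat (e ∷ M)) ≡ gap′ e + (∑ (across e) M + missing (flat M))
  missing-flat (x , y) M = begin
    gap x y + ∑ (gap x) (flat M) + (∑ (gap y) (flat M) + missing (flat M))
      ≡⟨ rearrange (gap x y) (∑ (gap x) (flat M)) (∑ (gap y) (flat M)) (missing (flat M)) ⟩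
    gap x y + (∑ (gap x) (flat M) + ∑ (gap y) (flat M) + missing (flat M))
      ≡⟨ cong (λ s → gap x y + (s + missing (flat M))) (cong₂ _+_ (∑-flat (gap x) M) (∑-flat (gap y) M)) ⟩
    gap x y + (∑ (λ e → gap x (proj₁ e) + gap x (proj₂ e)) M + ∑ (λ e → gap y (proj₁ e) + gap y (proj₂ e)) M + missing (flat M))
      ≡⟨ cong (λ s → gap x y + (s + missing (flat M))) (∑-+ (λ e → gap x (proj₁ e) + gap x (proj₂ e)) (λ e → gap y (proj₁ e) + gap y (proj₂ e)) M) ⟨
    gap x y + (∑ (across (x , y)) M + missing (flat M)) ∎
    where
    open ≡-Reasoning
    rearrange : ∀ a b c d → a + b + (c + d) ≡ a + (b + c + d)
    rearrange = solve-∀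

  Edge : Pair → Set
  Edge (x , y) = A x y ≡ true

  gap-edge : ∀ e → Edge e → gap′ e ≡ 0
  gap-edge (x , y) eq rewrite eq = refl

  -- For a list without repetitions, a perfect matching of the induced subgraph. Phrased with
  -- permutations, so that matchings can be concatenated and vertices reordered without disjointness
  -- conditions.
  Matchable : List V → Set
  Matchable L = Σ (List Pair) λ N → flat N ↭ L × All Edge N

  Matchable-↭ : ∀ {L L'} → L ↭ L' → Matchable L → Matchable L'
  Matchable-↭ σ (N , τ , es) = N , trans τ σ , es

  ¬Matchable-drop : ∀ {L K} → All Edge K → ¬ Matchable (L ++ flat K) → ¬ Matchable L
  ¬Matchable-drop {L} {K} ks ¬m (N , τ , es) =
    ¬m (N ++ K , trans (↭-reflexive (flat-++ N K)) (++⁺ τ refl) , AllP.++⁺ es ks)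

  -- When `M` is a matching that leaves just the two ends of `p` uncovered, this is by Berge's
  -- theorem the absence of `M`-augmenting paths between these ends.
  Stuck : Pair → List Pair → Set
  Stuck p M = ¬ Matchable (flat (p ∷ M))

  Stuck-↭ : ∀ {p M N} → M ↭ N → Stuck p M → Stuck p N
  Stuck-↭ {p} σ st m = st (Matchable-↭ (flat-↭ (prep p (↭-sym σ))) m)

  Stuck-flip : ∀ {p M} → Stuck p M → Stuck (flip p) M
  Stuck-flip {p} {M} st m = st (Matchable-↭ (swap (proj₂ p) (proj₁ p) refl) m)

  Stuck-flip-head : ∀ {p e M} → Stuck p (e ∷ M) → Stuck p (flip e ∷ M)
  Stuck-flip-head {p} {e} {M} st m = st (Matchable-↭ (prep (proj₁ p) (prep (proj₂ p) (swap (proj₂ e) (proj₁ e) refl))) m)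

  Stuck-flip-second : ∀ {p e f M} → Stuck p (e ∷ f ∷ M) → Stuck p (e ∷ flip f ∷ M)
  Stuck-flip-second st = Stuck-↭ (swap _ _ refl) (Stuck-flip-head (Stuck-↭ (swap _ _ refl) st))

  Stuck-flip-third : ∀ {p e f g M} → Stuck p (e ∷ f ∷ g ∷ M) → Stuck p (e ∷ f ∷ flip g ∷ M)
  Stuck-flip-third {e = e} {f} {g} {M} st =
    Stuck-↭ (↭-sym (shift (flip g) (e ∷ f ∷ []) M)) (Stuck-flip-head (Stuck-↭ (shift g (e ∷ f ∷ []) M) st))

  -- Matching edges that an augmenting path does not meet can stay, so a path through part of a
  -- matching already augments all of it. Short paths are thus excluded by looking only at the edges
  -- they use.
  Stuck-prefix : ∀ {p} M {K} → All Edge K → Stuck p (M ++ K) → Stuck p M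
  Stuck-prefix {p} M {K} ks st =
    ¬Matchable-drop ks (λ m → st (Matchable-↭ (↭-reflexive (sym (flat-++ (p ∷ M) K))) m))

  Stuck-tail : ∀ {p e M} → Edge e → Stuck p (e ∷ M) → Stuck p M
  Stuck-tail {p} {e} {M} edge st = Stuck-prefix M (edge ∷ []) (Stuck-↭ (++-comm (e ∷ []) M) st)

  Edge-flip : ∀ {e} → Edge e → Edge (flip e)
  Edge-flip {x , y} eq = ≡.trans (A-sym y x) eq

-- Finite Boolean checks for one and for two matching edges.

-- Evaluates all 2^n cases, so that a finite case analysis becomes a single `refl`.
allVec : ∀ n → (Vec Bool n → Bool) → Bool
allVec zero    f = f Vec.[]
allVec (suc n) f = allVec n (λ v → f (true Vec.∷ v)) ∧ allVec n (λ v → f (false Vec.∷ v))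

∧-true : ∀ {x y} → x ∧ y ≡ true → x ≡ true × y ≡ true
∧-true {true} {true} _ = refl , refl

allVec-sound : ∀ n f → allVec n f ≡ true → ∀ v → f v ≡ true
allVec-sound zero    f eq Vec.[]            = eq
allVec-sound (suc n) f eq (true Vec.∷ v)  = allVec-sound n _ (proj₁ (∧-true eq)) v
allVec-sound (suc n) f eq (false Vec.∷ v) = allVec-sound n _ (proj₂ (∧-true {allVec n (λ v → f (true Vec.∷ v))} eq)) v

∨-false : ∀ {x y} → x ≡ false → x ∨ y ≡ true → y ≡ true
∨-false refl eq = eq

any-of : List Bool → Bool
any-of []       = false
any-of (x ∷ xs) = x ∨ any-of xs

none-of : ∀ {xs} → All (_≡ false) xs → any-of xs ≡ false
none-of []          = refl
none-of (refl ∷ es) = none-of es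

-- The contribution of one matching edge to T; `extraˡ` and `extraʳ` give those to P and Q. Their
-- truncated subtractions lose nothing, by `common+extraˡ` and `common+extraʳ`.
common : (a₁ a₂ b₁ b₂ : Bool) → ℕ
common a₁ a₂ b₁ b₂ = ind ((a₁ ∧ b₁) ∨ (a₂ ∧ b₂))

extraˡ extraʳ : (a₁ a₂ b₁ b₂ : Bool) → ℕ
extraˡ a₁ a₂ b₁ b₂ = ind a₁ + ind a₂ ∸ common a₁ a₂ b₁ b₂
extraʳ a₁ a₂ b₁ b₂ = ind b₁ + ind b₂ ∸ common a₁ a₂ b₁ b₂

ind≤1 : ∀ b → ind b ≤ 1
ind≤1 true  = s≤s z≤n
ind≤1 false = z≤n

ind-∨-≤ : ∀ x y → ind (x ∨ y) ≤ ind x + ind y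
ind-∨-≤ true  y = s≤s z≤n
ind-∨-≤ false y = ≤-refl

ind-∧-≤ˡ : ∀ x y → ind (x ∧ y) ≤ ind x
ind-∧-≤ˡ true  y = ind≤1 y
ind-∧-≤ˡ false y = z≤n

ind-∧-≤ʳ : ∀ x y → ind (x ∧ y) ≤ ind y
ind-∧-≤ʳ true  y = ≤-refl
ind-∧-≤ʳ false y = z≤n

common+extraˡ : ∀ a₁ a₂ b₁ b₂ → common a₁ a₂ b₁ b₂ + extraˡ a₁ a₂ b₁ b₂ ≡ ind a₁ + ind a₂
common+extraˡ a₁ a₂ b₁ b₂ = m+[n∸m]≡n (≤-trans (ind-∨-≤ (a₁ ∧ b₁) (a₂ ∧ b₂)) (+-mono-≤ (ind-∧-≤ˡ a₁ b₁) (ind-∧-≤ˡ a₂ b₂)))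

common+extraʳ : ∀ a₁ a₂ b₁ b₂ → common a₁ a₂ b₁ b₂ + extraʳ a₁ a₂ b₁ b₂ ≡ ind b₁ + ind b₂
common+extraʳ a₁ a₂ b₁ b₂ = m+[n∸m]≡n (≤-trans (ind-∨-≤ (a₁ ∧ b₁) (a₂ ∧ b₂)) (+-mono-≤ (ind-∧-≤ʳ a₁ b₁) (ind-∧-≤ʳ a₂ b₂)))

single-check : Vec Bool 4 → Bool
single-check (a₁ Vec.∷ a₂ Vec.∷ b₁ Vec.∷ b₂ Vec.∷ Vec.[]) =
  any-of ((a₁ ∧ b₂) ∷ (a₂ ∧ b₁) ∷ []) ∨
  (let t = common a₁ a₂ b₁ b₂ ; p = extraˡ a₁ a₂ b₁ b₂ ; q = extraʳ a₁ a₂ b₁ b₂ in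
   (t * (p + q) + p * q ≤ᵇ 0) ∧ (t + p + (t + q) ≤ᵇ 2))

-- aᵢ, bᵢ (cᵢ, dᵢ) tell whether a, b are adjacent to the i-th end of the first (second) of two matching
-- edges, and kᵢⱼ whether the i-th end of the first is adjacent to the j-th end of the second.  The
-- disjunction lists all augmenting paths from a to b through these edges.
double-check : Vec Bool 12 → Bool
double-check (a₁ Vec.∷ a₂ Vec.∷ b₁ Vec.∷ b₂ Vec.∷ c₁ Vec.∷ c₂ Vec.∷ d₁ Vec.∷ d₂ Vec.∷
              k₁₁ Vec.∷ k₁₂ Vec.∷ k₂₁ Vec.∷ k₂₂ Vec.∷ Vec.[]) =
  any-of ((a₁ ∧ b₂) ∷ (a₂ ∧ b₁) ∷ (c₁ ∧ d₂) ∷ (c₂ ∧ d₁) ∷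
          (a₁ ∧ (k₂₁ ∧ d₂)) ∷ (a₂ ∧ (k₁₁ ∧ d₂)) ∷ (a₁ ∧ (k₂₂ ∧ d₁)) ∷ (a₂ ∧ (k₁₂ ∧ d₁)) ∷
          (b₁ ∧ (k₂₁ ∧ c₂)) ∷ (b₂ ∧ (k₁₁ ∧ c₂)) ∷ (b₁ ∧ (k₂₂ ∧ c₁)) ∷ (b₂ ∧ (k₁₂ ∧ c₁)) ∷ []) ∨
  (let t = common a₁ a₂ b₁ b₂ ; p = extraˡ a₁ a₂ b₁ b₂ ; q = extraʳ a₁ a₂ b₁ b₂
       t′ = common c₁ c₂ d₁ d₂ ; p′ = extraˡ c₁ c₂ d₁ d₂ ; q′ = extraʳ c₁ c₂ d₁ d₂ in
   t * (t′ + p′ + q′) + p * (t′ + q′) + q * (t′ + p′)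
     ≤ᵇ ind (not k₁₁) + ind (not k₁₂) + (ind (not k₂₁) + ind (not k₂₂)))

-- Each `refl` evaluates its check on every vector, 16 and 4096 of them; `abstract` keeps the proofs
-- from being unfolded later.
abstract
  single-checked : ∀ v → single-check v ≡ true
  single-checked = allVec-sound 4 single-check refl

  double-checked : ∀ v → double-check v ≡ true
  double-checked = allVec-sound 12 double-check refl

≤ᵇ-true : ∀ m n → (m ≤ᵇ n) ≡ true → m ≤ n
≤ᵇ-true m n eq = ≤ᵇ⇒≤ m n (Equivalence.from T-≡ eq)

-- Weights of matching edges relative to an unmatched pair.

module Weights {V : Set} (A : V → V → Bool) (A-sym : ∀ x y → A x y ≡ A y x) (a b : V) where
  open Matchings A A-sym

  p : Pair
  p = a , b

  tw pw qw : Pair → ℕ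
  tw (x , y) = common (A a x) (A a y) (A b x) (A b y)
  pw (x , y) = extraˡ (A a x) (A a y) (A b x) (A b y)
  qw (x , y) = extraʳ (A a x) (A a y) (A b x) (A b y)

  tw≤1 : ∀ e → tw e ≤ 1
  tw≤1 (x , y) = ind≤1 ((A a x ∧ A b x) ∨ (A a y ∧ A b y))

  deg-left : ∀ M → deg a (flat M) ≡ ∑ tw M + ∑ pw M
  deg-left M = ≡.trans (∑-flat (λ x → ind (A a x)) M) (≡.trans
    (∑-cong (All.universal (λ (x , y) → sym (common+extraˡ (A a x) (A a y) (A b x) (A b y))) M)) (∑-+ tw pw M))

  deg-right : ∀ M → deg b (flat M) ≡ ∑ tw M + ∑ qw M
  deg-right M = ≡.trans (∑-flat (λ x → ind (A b x)) M) (≡.trans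
    (∑-cong (All.universal (λ (x , y) → sym (common+extraʳ (A a x) (A a y) (A b x) (A b y))) M)) (∑-+ tw qw M))

  -- Each of `a` and `b` is either adjacent or non-adjacent to each of the 2m vertices of `M`, where
  -- m is the length of `M`; the bracket is the sum of their degrees into `M`.
  across-unmatched : ∀ M → ∑ (across p) M + (∑ tw M + ∑ pw M + (∑ tw M + ∑ qw M)) ≡ 4 * length M
  across-unmatched M = begin
    ∑ (across p) M + (∑ tw M + ∑ pw M + (∑ tw M + ∑ qw M))
      ≡⟨ cong (∑ (across p) M +_) (cong₂ _+_ (deg-left M) (deg-right M)) ⟨
    ∑ (across p) M + (deg a (flat M) + deg b (flat M))
      ≡⟨ cong (_+ (deg a (flat M) + deg b (flat M))) across≡gaps ⟩
    ∑ (gap a) (flat M) + ∑ (gap b) (flat M) + (deg a (flat M) + deg b (flat M))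
      ≡⟨ rearrange (∑ (gap a) (flat M)) (∑ (gap b) (flat M)) (deg a (flat M)) (deg b (flat M)) ⟩
    deg a (flat M) + ∑ (gap a) (flat M) + (deg b (flat M) + ∑ (gap b) (flat M))
      ≡⟨ cong₂ _+_ (deg+gaps a (flat M)) (deg+gaps b (flat M)) ⟩
    length (flat M) + length (flat M)
      ≡⟨ cong (λ k → k + k) (flat-length M) ⟩
    2 * length M + 2 * length M
      ≡⟨ 2+2 (length M) ⟩
    4 * length M ∎
    where
    open ≡-Reasoning
    rearrange : ∀ a b c d → a + b + (c + d) ≡ c + a + (d + b)
    rearrange = solve-∀
    2+2 : ∀ m → 2 * m + 2 * m ≡ 4 * m
    2+2 = solve-∀
    across≡gaps : ∑ (across p) M ≡ ∑ (gap a) (flat M) + ∑ (gap b) (flat M)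
    across≡gaps = ≡.trans (∑-+ (λ e → gap a (proj₁ e) + gap a (proj₂ e)) (λ e → gap b (proj₁ e) + gap b (proj₂ e)) M)
      (sym (cong₂ _+_ (∑-flat (gap a) M) (∑-flat (gap b) M)))

-- A lower bound for the non-edges among the matched vertices, see `forced≤missing`. Its terms count
-- pairs of contributions: two to T, one to T and one to P or Q, one to P and one to Q.
forced : ℕ → ℕ → ℕ → ℕ
forced T P Q = tri T + (T * (P + Q) + P * Q)

-- Augmenting paths of length 1, 3, 5 and 7.

module Augment {V : Set} (A : V → V → Bool) (A-sym : ∀ x y → A x y ≡ A y x) where
  open Matchings A A-sym

  -- An edge `ab` would be an augmenting path of length 1. The next three exclude paths of length 3,
  -- 5 and 7, each for one order and orientation of the matching edges; other orientations are
  -- obtained by flips.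
  stuck₀ : ∀ {a b} → Stuck (a , b) [] → A a b ≡ false
  stuck₀ st = ≢true⇒≡false λ eq → st ((_ , _) ∷ [] , refl , eq ∷ [])

  stuck₁ : ∀ {a b x y} → Stuck (a , b) ((x , y) ∷ []) → A a x ∧ A b y ≡ false
  stuck₁ {a} {b} {x} {y} st = ≢true⇒≡false λ eq → let ax , by = ∧-true eq in
    st ((a , x) ∷ (b , y) ∷ [] , prep a (swap x b refl) , ax ∷ by ∷ [])

  stuck₂ : ∀ {a b x y z w} → Stuck (a , b) ((x , y) ∷ (z , w) ∷ []) → A a x ∧ (A y z ∧ A b w) ≡ false
  stuck₂ {a} {b} {x} {y} {z} {w} st = ≢true⇒≡false λ eq →
    let ax , eq′ = ∧-true eq
        yz , bw  = ∧-true {A y z} eq′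
    in st ((a , x) ∷ (y , z) ∷ (b , w) ∷ [] , prep a (shift b (x ∷ y ∷ z ∷ []) (w ∷ [])) , ax ∷ yz ∷ bw ∷ [])

  -- The excluded path is a, x, y, u, v, w, z, b. Its middle edge `uv` stands first in the list so
  -- that `Stuck-flip-head` gives the second path, which runs through `uv` backwards.
  stuck₃ : ∀ {a b x y z w u v} → A a x ≡ true → A b z ≡ true →
           Stuck (a , b) ((u , v) ∷ (x , y) ∷ (z , w) ∷ []) → A u y ∧ A v w ≡ false
  stuck₃ {a} {b} {x} {y} {z} {w} {u} {v} ax bz st = ≢true⇒≡false λ eq →
    let uy , vw = ∧-true eq
    in st ((a , x) ∷ (u , y) ∷ (v , w) ∷ (b , z) ∷ [] , prep a σ , ax ∷ uy ∷ vw ∷ bz ∷ [])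
    where
    σ : x ∷ u ∷ y ∷ v ∷ w ∷ b ∷ z ∷ [] ↭ b ∷ u ∷ v ∷ x ∷ y ∷ z ∷ w ∷ []
    σ = trans (shift b (x ∷ u ∷ y ∷ v ∷ w ∷ []) (z ∷ []))
        (prep b (trans (swap x u (swap y v refl)) (prep u (swap x v (prep y (swap w z refl))))))

  stuck₁-pairs : ∀ {a b} e → Stuck (a , b) (e ∷ []) →
                 All (_≡ false) ((A a (proj₁ e) ∧ A b (proj₂ e)) ∷ (A a (proj₂ e) ∧ A b (proj₁ e)) ∷ [])
  stuck₁-pairs e st = stuck₁ st ∷ stuck₁ (Stuck-flip-head st) ∷ []

-- Non-edges forced by the absence of short augmenting paths.

module Unmatched {V : Set} (A : V → V → Bool) (A-sym : ∀ x y → A x y ≡ A y x) (a b : V) where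
  open Matchings A A-sym
  open Augment A A-sym
  open Weights A A-sym a b public

  -- Without paths of length 3 an edge contributes to only one of T, P and Q. The vanishing of the
  -- mixed products removes the diagonal terms in `forced≤missing`; the second bound feeds
  -- `weight≤`.
  single : ∀ e → Stuck p (e ∷ []) → tw e * (pw e + qw e) + pw e * qw e ≡ 0 × tw e + pw e + (tw e + qw e) ≤ 2
  single (x , y) st with ∧-true {tw (x , y) * (pw (x , y) + qw (x , y)) + pw (x , y) * qw (x , y) ≤ᵇ 0} (∨-false
    (none-of (stuck₁-pairs (x , y) st))
    (single-checked (A a x Vec.∷ A a y Vec.∷ A b x Vec.∷ A b y Vec.∷ Vec.[])))
  ... | h , h′ = n≤0⇒n≡0 (≤ᵇ-true _ 0 h) , ≤ᵇ-true _ 2 h′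

  -- The bilinear part of `forced`: the mixed terms that arise when the contributions of `e` are
  -- added to those of `f`.
  bound : Pair → Pair → ℕ
  bound e f = tw e * (tw f + pw f + qw f) + pw e * (tw f + qw f) + qw e * (tw f + pw f)

  double : ∀ e f → Edge e → Edge f → Stuck p (e ∷ f ∷ []) → bound e f ≤ across e f
  double e@(x , y) f@(z , w) edge-e edge-f st = ≤ᵇ-true (bound e f) (across e f) (∨-false
    -- The excluded paths in the order of `double-check`: length 3 through `e`, length 3 through
    -- `f`, then length 5 with `e` next to `a`, and with `e` next to `b`, each in four orientations.
    (none-of (AllP.++⁺ (stuck₁-pairs e (Stuck-prefix (e ∷ []) (edge-f ∷ []) st))
             (AllP.++⁺ (stuck₁-pairs f (Stuck-tail edge-e st))
      ( stuck₂ st ∷ stuck₂ fe ∷ stuck₂ ff ∷ stuck₂ fef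
      ∷ stuck₂ (Stuck-flip st) ∷ stuck₂ (Stuck-flip fe) ∷ stuck₂ (Stuck-flip ff) ∷ stuck₂ (Stuck-flip fef) ∷ []))))
    (double-checked (A a x Vec.∷ A a y Vec.∷ A b x Vec.∷ A b y Vec.∷ A a z Vec.∷ A a w Vec.∷ A b z Vec.∷ A b w Vec.∷
                     A x z Vec.∷ A x w Vec.∷ A y z Vec.∷ A y w Vec.∷ Vec.[])))
    where
    fe : Stuck p (flip e ∷ f ∷ [])
    fe = Stuck-flip-head st
    ff : Stuck p (e ∷ flip f ∷ [])
    ff = Stuck-flip-second st
    fef : Stuck p (flip e ∷ flip f ∷ [])
    fef = Stuck-flip-head ff

  double-all : ∀ {e M} → Edge e → All Edge M → Stuck p (e ∷ M) → All (λ f → bound e f ≤ across e f) M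
  double-all edge []             st = []
  double-all {e} edge (edge-f ∷ es) st =
    double e _ edge edge-f (Stuck-prefix _ es st) ∷
    double-all edge es (Stuck-tail edge-f (Stuck-↭ (swap _ _ refl) st))

  ∑-bound : ∀ e M → ∑ (bound e) M ≡ tw e * (∑ tw M + ∑ pw M + ∑ qw M) + pw e * (∑ tw M + ∑ qw M) + qw e * (∑ tw M + ∑ pw M)
  ∑-bound e []      = sym (cong₂ _+_ (cong₂ _+_ (*-zeroʳ (tw e)) (*-zeroʳ (pw e))) (*-zeroʳ (qw e)))
  ∑-bound e (f ∷ M) = ≡.trans (cong (bound e f +_) (∑-bound e M))
    (rearrange (tw e) (pw e) (qw e) (tw f) (pw f) (qw f) (∑ tw M) (∑ pw M) (∑ qw M))
    where
    rearrange : ∀ t p q t′ p′ q′ T P Q →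
      t * (t′ + p′ + q′) + p * (t′ + q′) + q * (t′ + p′) + (t * (T + P + Q) + p * (T + Q) + q * (T + P)) ≡
      t * (t′ + T + (p′ + P) + (q′ + Q)) + p * (t′ + T + (q′ + Q)) + q * (t′ + T + (p′ + P))
    rearrange = solve-∀

  tri-step : ∀ {t} T → t ≤ 1 → tri (t + T) ≡ t * T + tri T
  tri-step T z≤n       = refl
  tri-step T (s≤s z≤n) = cong (_+ tri T) (sym (+-identityʳ T))

  -- Induction on `M`. By `tri-step` and `single`, a new edge `e` raises `forced` by exactly the sum
  -- of `bound e f` over the old edges `f`, and by `double` each summand is covered by non-edges
  -- between `e` and `f`.
  forced≤missing : ∀ M → All Edge M → Stuck p M → forced (∑ tw M) (∑ pw M) (∑ qw M) ≤ missing (flat M)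
  forced≤missing []      []            st = z≤n
  forced≤missing (e ∷ M) (edge ∷ es) st = begin
    tri (t + T) + ((t + T) * (p′ + P + (q + Q)) + (p′ + P) * (q + Q))
      ≡⟨ cong (_+ ((t + T) * (p′ + P + (q + Q)) + (p′ + P) * (q + Q))) (tri-step T (tw≤1 e)) ⟩
    t * T + tri T + ((t + T) * (p′ + P + (q + Q)) + (p′ + P) * (q + Q))
      ≡⟨ rearrange t p′ q T P Q (tri T) ⟩
    t * (p′ + q) + p′ * q + (t * (T + P + Q) + p′ * (T + Q) + q * (T + P) + forced T P Q)
      ≡⟨ cong (_+ (t * (T + P + Q) + p′ * (T + Q) + q * (T + P) + forced T P Q)) (proj₁ (single e (Stuck-prefix (e ∷ []) es st))) ⟩
    t * (T + P + Q) + p′ * (T + Q) + q * (T + P) + forced T P Q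
      ≡⟨ cong (_+ forced T P Q) (∑-bound e M) ⟨
    ∑ (bound e) M + forced T P Q
      ≤⟨ +-mono-≤ (∑-mono (double-all edge es st)) (forced≤missing M es (Stuck-tail edge st)) ⟩
    ∑ (across e) M + missing (flat M)
      ≡⟨ cong (_+ (∑ (across e) M + missing (flat M))) (gap-edge e edge) ⟨
    gap′ e + (∑ (across e) M + missing (flat M))
      ≡⟨ missing-flat e M ⟨
    missing (flat (e ∷ M)) ∎
    where
    open ≤-Reasoning
    t = tw e ; p′ = pw e ; q = qw e
    T = ∑ tw M ; P = ∑ pw M ; Q = ∑ qw M
    rearrange : ∀ t p q T P Q R →
      t * T + R + ((t + T) * (p + P + (q + Q)) + (p + P) * (q + Q)) ≡
      t * (p + q) + p * q + (t * (T + P + Q) + p * (T + Q) + q * (T + P) + (R + (T * (P + Q) + P * Q)))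
    rearrange = solve-∀

  Hub : Pair → Set
  Hub (x , y) = A a x ≡ true × A b x ≡ true

  hub : ∀ e → 1 ≤ tw e → Hub e ⊎ Hub (flip e)
  hub (x , y) le with A a x ∧ A b x in eq | A a y ∧ A b y in eq′
  ... | true  | _    = inj₁ (∧-true eq)
  ... | false | true = inj₂ (∧-true eq′)

  gap∧ : ∀ {x y} → x ∧ y ≡ false → 1 ≤ ind (not x) + ind (not y)
  gap∧ {true}  {false} _ = s≤s z≤n
  gap∧ {false} {y}     _ = s≤s z≤n

  -- Two paths of length 7 run through `f`, one in each direction. One lacks `uy` or `vw`, the other
  -- `vy` or `uw`; these four pairs are counted separately, so two non-edges result.
  two-hubs : ∀ f {e₁ e₂} → Hub e₁ → Hub e₂ → Stuck p (f ∷ e₁ ∷ e₂ ∷ []) → 2 ≤ across f e₁ + across f e₂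
  two-hubs (u , v) {x , y} {z , w} (ax , _) (_ , bz) st = begin
    1 + 1
      ≤⟨ +-mono-≤ (gap∧ {A u y} (stuck₃ ax bz st)) (gap∧ {A v y} (stuck₃ ax bz (Stuck-flip-head st))) ⟩
    gap u y + gap v w + (gap v y + gap u w)
      ≤⟨ m≤m+n _ (gap u x + gap v x + (gap u z + gap v z)) ⟩
    gap u y + gap v w + (gap v y + gap u w) + (gap u x + gap v x + (gap u z + gap v z))
      ≡⟨ rearrange (gap u y) (gap v w) (gap v y) (gap u w) (gap u x) (gap v x) (gap u z) (gap v z) ⟩
    gap u x + gap u y + (gap v x + gap v y) + (gap u z + gap u w + (gap v z + gap v w)) ∎
    where
    open ≤-Reasoning
    rearrange : ∀ uy vw vy uw ux vx uz vz → uy + vw + (vy + uw) + (ux + vx + (uz + vz)) ≡ ux + uy + (vx + vy) + (uz + uw + (vz + vw))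
    rearrange = solve-∀

  across-flip : ∀ f e → across f (flip e) ≡ across f e
  across-flip (u , v) (x , y) = cong₂ _+_ (+-comm (gap u y) (gap u x)) (+-comm (gap v y) (gap v x))

  two-common : ∀ f e₁ e₂ → 1 ≤ tw e₁ → 1 ≤ tw e₂ → Stuck p (f ∷ e₁ ∷ e₂ ∷ []) → 2 ≤ across f e₁ + across f e₂
  two-common f e₁ e₂ le₁ le₂ st with hub e₁ le₁ | hub e₂ le₂
  ... | inj₁ h | inj₁ k = two-hubs f h k st
  ... | inj₂ h | inj₁ k = subst (λ c → 2 ≤ c + across f e₂) (across-flip f e₁) (two-hubs f h k (Stuck-flip-second st))
  ... | inj₁ h | inj₂ k = subst (λ c → 2 ≤ across f e₁ + c) (across-flip f e₂) (two-hubs f h k (Stuck-flip-third st))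
  ... | inj₂ h | inj₂ k = subst (2 ≤_) (cong₂ _+_ (across-flip f e₁) (across-flip f e₂))
                            (two-hubs f h k (Stuck-flip-third (Stuck-flip-second st)))

-- Arithmetic of the edge bound.

-- The two bounds leave `forced T P Q` no room above 0, while the degree sum is at least 4. Then T =
-- 0, since T = 1 would need P = Q = 0 and T ≥ 2 has a positive `tri T`; finally PQ = 0.
no-common-isolates : ∀ T P Q m → 2 ≤ m → forced T P Q + 2 * m ≤ T + P + (T + Q) → T + P + (T + Q) ≤ 2 * m →
                     T + P ≡ 0 ⊎ T + Q ≡ 0
no-common-isolates T P Q m 2≤m h h′ = by-T T P Q
  (n≤0⇒n≡0 (+-cancelʳ-≤ (2 * m) (forced T P Q) 0 (≤-trans h h′)))
  (≤-trans (*-monoʳ-≤ 2 2≤m) (≤-trans (m≤n+m (2 * m) (forced T P Q)) h))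
  where
  by-T : ∀ T P Q → forced T P Q ≡ 0 → 4 ≤ T + P + (T + Q) → T + P ≡ 0 ⊎ T + Q ≡ 0
  by-T zero zero    Q       eq le = inj₁ refl
  by-T zero (suc P) zero    eq le = inj₂ refl
  by-T zero (suc P) (suc Q) () le
  by-T 1 zero zero eq (s≤s (s≤s ()))
  by-T 1 zero (suc Q) () le
  by-T 1 (suc P) Q () le
  by-T (suc (suc T)) P Q () le

-- What remains of the inequality in `slack`, with R = P + Q. It reads (T - 1)R + PQ + s ≤ 2T - 2 -
-- T(T-1)/2, and the right side is 1, 1, 0 for T = 2, 3, 4 and negative for T ≥ 5; the degree
-- conditions exclude T ≤ 1.
Slack : (T R s : ℕ) → Set
Slack T R s = (T ≡ 2 × R + s ≤ 1) ⊎ (T ≡ 3 × 2 * R + s ≤ 1) ⊎ (T ≡ 4 × 3 * R + s ≤ 0)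

slack : ∀ T P Q s → 2 ≤ T + P → 2 ≤ T + Q → forced T P Q + (2 + s) ≤ T + P + (T + Q) → Slack T (P + Q) s
slack 0 (suc (suc P)) (suc (suc Q)) s le le′ h = ⊥-elim (n≮0 (≤-by {a = 2} {0} (P + Q + P * Q + s) h (eq P Q s)))
  where
  eq : ∀ P Q s → 2 + (2 + P + (2 + Q)) + (P + Q + P * Q + s) ≡ (2 + P) * (2 + Q) + (2 + s) + 0
  eq = solve-∀
slack 0 1 Q s (s≤s ()) le′ h
slack 0 (suc (suc P)) 1 s le (s≤s ()) h
slack 1 zero Q s (s≤s ()) le′ h
slack 1 (suc P) zero s le (s≤s ()) h
slack 1 (suc P) (suc Q) s le le′ h = ⊥-elim (n≮0 (≤-by {a = 1} {0} (P + Q + P * Q + s) h (eq P Q s)))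
  where
  eq : ∀ P Q s → 1 + (1 + (1 + P) + (1 + (1 + Q))) + (P + Q + P * Q + s) ≡
                 1 * (1 + P + (1 + Q)) + (1 + P) * (1 + Q) + (2 + s) + 0
  eq = solve-∀
slack 2 P Q s le le′ h = inj₁ (refl , ≤-by (P * Q) h (eq P Q s))
  where
  eq : ∀ P Q s → P + Q + s + (2 + P + (2 + Q)) + P * Q ≡ 1 + (2 * (P + Q) + P * Q) + (2 + s) + 1
  eq = solve-∀
slack 3 P Q s le le′ h = inj₂ (inj₁ (refl , ≤-by (P * Q) h (eq P Q s)))
  where
  eq : ∀ P Q s → 2 * (P + Q) + s + (3 + P + (3 + Q)) + P * Q ≡ 3 + (3 * (P + Q) + P * Q) + (2 + s) + 1
  eq = solve-∀
slack 4 P Q s le le′ h = inj₂ (inj₂ (refl , ≤-by (P * Q) h (eq P Q s)))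
  where
  eq : ∀ P Q s → 3 * (P + Q) + s + (4 + P + (4 + Q)) + P * Q ≡ 6 + (4 * (P + Q) + P * Q) + (2 + s) + 0
  eq = solve-∀
slack (suc (suc (suc (suc (suc k))))) P Q s le le′ h = ⊥-elim (n≮0 (≤-by {a = 2} {0} (3 * k + tri k + 4 * (P + Q) + k * (P + Q) + P * Q + s) h (eq k (tri k) P Q s)))
  where
  eq : ∀ k r P Q s → 2 + (5 + k + P + (5 + k + Q)) + (3 * k + r + 4 * (P + Q) + k * (P + Q) + P * Q + s) ≡
       4 + k + (3 + k + (2 + k + (1 + k + (k + r)))) + ((5 + k) * (P + Q) + P * Q) + (2 + s) + 0
  eq = solve-∀

-- No case has room for two further non-edges, the number supplied by paths of length 7.
¬Slack-2 : ∀ {T R} → ¬ Slack T R 2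
¬Slack-2 {R = R} (inj₁ (_ , h)) with s≤s () ← ≤-trans (m≤n+m 2 R) h
¬Slack-2 {R = R} (inj₂ (inj₁ (_ , h))) with s≤s () ← ≤-trans (m≤n+m 2 (2 * R)) h
¬Slack-2 {R = R} (inj₂ (inj₂ (_ , h))) with () ← ≤-trans (m≤n+m 2 (3 * R)) h

Slack⇒2≤T : ∀ {T R s} → Slack T R s → 2 ≤ T
Slack⇒2≤T (inj₁ (refl , _)) = ≤-refl
Slack⇒2≤T (inj₂ (inj₁ (refl , _))) = s≤s (s≤s z≤n)
Slack⇒2≤T (inj₂ (inj₂ (refl , _))) = s≤s (s≤s z≤n)

-- Sparse m μ: with n = 2m + 2 and e removed, the edge bound of the theorem allows μ non-edges;
-- the cases n = 6 and n = 8 are one below the general 4m - 1 = 2n - 5.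
data Sparse : ℕ → ℕ → Set where
  small₂ : ∀ {μ} → μ ≤ 6 → Sparse 2 μ
  small₃ : ∀ {μ} → μ ≤ 10 → Sparse 3 μ
  large  : ∀ {m μ} → 4 ≤ m → suc μ ≤ 4 * m → Sparse m μ

-- For m ≥ 4, T + R is at most 3 in the first two cases of `Slack`, so only T = 4, R = 0 is left.
-- For m = 2 and m = 3 the sharper edge bound allows s = 1, which forces R = 0 and with it T = m.
extremal : ∀ {m μ T R} → Sparse m μ → T ≤ m → m ≤ T + R → (∀ s → suc μ + s ≤ 4 * m → Slack T R s) → T ≡ m × μ ≤ tri (2 + m) × m ≤ 4
extremal {m} {μ} (large 4≤m le) _ m≤ slk = go m≤ (slk 0 (≤-trans (≤-reflexive (+-identityʳ (suc μ))) le))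
  where
  go : ∀ {T R} → m ≤ T + R → Slack T R 0 → T ≡ m × μ ≤ tri (2 + m) × m ≤ 4
  go {R = R} m≤ (inj₁ (refl , R≤)) with s≤s (s≤s (s≤s ())) ← ≤-trans 4≤m (≤-trans m≤ (+-monoʳ-≤ 2 (≤-trans (m≤m+n R 0) R≤)))
  go {R = zero} m≤ (inj₂ (inj₁ (refl , R≤))) with s≤s (s≤s (s≤s ())) ← ≤-trans 4≤m m≤
  go {R = suc zero} m≤ (inj₂ (inj₁ (refl , s≤s ())))
  go {R = suc (suc R)} m≤ (inj₂ (inj₁ (refl , s≤s ())))
  go {R = zero} m≤ (inj₂ (inj₂ (refl , R≤))) with refl ← ≤-antisym 4≤m m≤ = refl , ≤-pred le , ≤-refl
extremal {μ = μ} (small₂ le) T≤m _ slk = go T≤m (slk 1 (≤-trans (≤-reflexive (+-comm (suc μ) 1)) (s≤s (s≤s le))))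
  where
  go : ∀ {T R} → T ≤ 2 → Slack T R 1 → T ≡ 2 × μ ≤ 6 × 2 ≤ 4
  go T≤2 (inj₁ (T≡2 , _)) = T≡2 , le , s≤s (s≤s z≤n)
  go (s≤s (s≤s ())) (inj₂ (inj₁ (refl , _)))
  go (s≤s (s≤s ())) (inj₂ (inj₂ (refl , _)))
extremal {μ = μ} (small₃ le) T≤m m≤ slk = go T≤m m≤ (slk 1 (≤-trans (≤-reflexive (+-comm (suc μ) 1)) (s≤s (s≤s le))))
  where
  go : ∀ {T R} → T ≤ 3 → 3 ≤ T + R → Slack T R 1 → T ≡ 3 × μ ≤ 10 × 3 ≤ 4
  go {R = zero} T≤3 (s≤s (s≤s ())) (inj₁ (refl , _))
  go {R = suc zero} T≤3 m≤ (inj₁ (refl , s≤s ()))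
  go {R = suc (suc R)} T≤3 m≤ (inj₁ (refl , s≤s ()))
  go T≤3 m≤ (inj₂ (inj₁ (T≡3 , _))) = T≡3 , le , s≤s (s≤s (s≤s z≤n))
  go (s≤s (s≤s (s≤s ()))) m≤ (inj₂ (inj₂ (refl , _)))

sparse-strict : ∀ {m μ} → Sparse m μ → suc μ ≤ 4 * m
sparse-strict (large _ le) = le
sparse-strict (small₂ le)  = s≤s (≤-trans le (n≤1+n 6))
sparse-strict (small₃ le)  = s≤s (≤-trans le (n≤1+n 10))

true≢false : true ≢ false
true≢false ()

-- Equality in the counting and the structure it forces.

module Extremal {V : Set} (A : V → V → Bool) (A-sym : ∀ x y → A x y ≡ A y x) where
  open Matchings A A-sym
  open Augment A A-sym

  All-Adj None-Adj : List V → Set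
  All-Adj  = AllPairs (λ x y → A x y ≡ true)
  None-Adj = AllPairs (λ x y → A x y ≡ false)

  Joined : List V → List V → Set
  Joined X Y = All (λ x → All (λ y → A x y ≡ true) Y) X

  gaps≡0 : ∀ {x} L → ∑ (gap x) L ≡ 0 → All (λ y → A x y ≡ true) L
  gaps≡0 {x} L eq = All.map ind-not≡0⇒true (∑≡0⇒All (gap x) L eq)

  missing≡0 : ∀ L → missing L ≡ 0 → All-Adj L
  missing≡0 []      eq = []
  missing≡0 (x ∷ L) eq = gaps≡0 L (m+n≡0⇒m≡0 _ eq) ∷ missing≡0 L (m+n≡0⇒n≡0 (∑ (gap x) L) eq)

  between≡0 : ∀ X Y → between X Y ≡ 0 → Joined X Y
  between≡0 X Y eq = All.map (gaps≡0 Y) (∑≡0⇒All (λ x → ∑ (gap x) Y) X eq)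

  all-gaps : ∀ {x L} → All (λ y → A x y ≡ false) L → ∑ (gap x) L ≡ length L
  all-gaps []           = refl
  all-gaps (eq ∷ es) rewrite eq = cong suc (all-gaps es)

  missing-independent : ∀ {L} → None-Adj L → missing L ≡ tri (length L)
  missing-independent []       = refl
  missing-independent (e ∷ es) = cong₂ _+_ (all-gaps e) (missing-independent es)

  deg≡0 : ∀ {x} L → deg x L ≡ 0 → All (λ y → A x y ≡ false) L
  deg≡0 {x} L eq = All.map ind≡0⇒false (∑≡0⇒All (λ y → ind (A x y)) L eq)

  module _ (a b : V) where
    open Unmatched A A-sym a b

    weight : List Pair → ℕ
    weight M = ∑ tw M + ∑ pw M + (∑ tw M + ∑ qw M)

    -- Counts the pair `ab`, the 4m - deg a - deg b non-edges from `a` and `b` to the matched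
    -- vertices, and those among the matched vertices. Here `d` stands for non-edges beyond the
    -- forced ones: 0, or 2 from `bonus`.
    central : ∀ M d → Stuck p M → All Edge M → forced (∑ tw M) (∑ pw M) (∑ qw M) + d ≤ missing (flat M) →
              1 + 4 * length M + (forced (∑ tw M) (∑ pw M) (∑ qw M) + d) ≤ missing (flat (p ∷ M)) + weight M
    central M d st es le = begin
      1 + 4 * length M + F+d
        ≡⟨ cong (λ k → 1 + k + F+d) (across-unmatched M) ⟨
      1 + (∑ (across p) M + weight M) + F+d
        ≤⟨ +-monoʳ-≤ (1 + (∑ (across p) M + weight M)) le ⟩
      1 + (∑ (across p) M + weight M) + missing (flat M)
        ≡⟨ rearrange (∑ (across p) M) (weight M) (missing (flat M)) ⟩
      1 + (∑ (across p) M + missing (flat M)) + weight M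
        ≡⟨ cong (λ g → ind (not g) + (∑ (across p) M + missing (flat M)) + weight M) (stuck₀ (Stuck-prefix [] es st)) ⟨
      gap a b + (∑ (across p) M + missing (flat M)) + weight M
        ≡⟨ cong (_+ weight M) (missing-flat p M) ⟨
      missing (flat (p ∷ M)) + weight M ∎
      where
      open ≤-Reasoning
      F+d = forced (∑ tw M) (∑ pw M) (∑ qw M) + d
      rearrange : ∀ x y z → 1 + (x + y) + z ≡ 1 + (x + z) + y
      rearrange = solve-∀

    forced+0≤missing : ∀ M → All Edge M → Stuck p M → forced (∑ tw M) (∑ pw M) (∑ qw M) + 0 ≤ missing (flat M)
    forced+0≤missing M es st = ≤-trans (≤-reflexive (+-identityʳ _)) (forced≤missing M es st)

    single-all : ∀ M → All Edge M → Stuck p M → All (λ e → tw e + pw e + (tw e + qw e) ≤ 2) M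
    single-all []      []          st = []
    single-all (e ∷ M) (edge ∷ es) st =
      proj₂ (single e (Stuck-prefix (e ∷ []) es st)) ∷ single-all M es (Stuck-tail edge st)

    weight≤ : ∀ M → All Edge M → Stuck p M → weight M ≤ 2 * length M
    weight≤ M es st = begin
      weight M
        ≡⟨ cong₂ _+_ (∑-+ tw pw M) (∑-+ tw qw M) ⟨
      ∑ (λ e → tw e + pw e) M + ∑ (λ e → tw e + qw e) M
        ≡⟨ ∑-+ (λ e → tw e + pw e) (λ e → tw e + qw e) M ⟨
      ∑ (λ e → tw e + pw e + (tw e + qw e)) M
        ≤⟨ ∑-mono (single-all M es st) ⟩
      ∑ (λ _ → 2) M
        ≡⟨ ∑-const 2 M ⟩
      length M * 2
        ≡⟨ *-comm (length M) 2 ⟩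
      2 * length M ∎
      where open ≤-Reasoning

    -- The degree sum in `central` is at most 2m by `weight≤`. This weaker bound serves the graph
    -- left after removing a pendant vertex and its neighbour.
    stuck-missing : ∀ M → All Edge M → Stuck p M → 1 + 2 * length M ≤ missing (flat (p ∷ M))
    stuck-missing M es st =
      ≤-by F (+-mono-≤ (central M 0 st es (forced+0≤missing M es st)) (weight≤ M es st))
        (eq (length M) (missing (flat (p ∷ M))) (weight M) F)
      where
      F = forced (∑ tw M) (∑ pw M) (∑ qw M)
      eq : ∀ m μ S F → 1 + 2 * m + (μ + S + 2 * m) + F ≡ 1 + 4 * m + (F + 0) + S + μ
      eq = solve-∀

    isolated-head : ∀ x L → deg x L ≡ 0 → missing (x ∷ L) ≤ length L → missing L ≡ 0
    isolated-head x L eq le = n≤0⇒n≡0 (+-cancelˡ-≤ (length L) (missing L) 0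
      (≤-trans (≤-reflexive (cong (_+ missing L) (sym (all-gaps (deg≡0 L eq))))) (≤-trans le (≤-reflexive (sym (+-identityʳ _))))))

    -- The equality case of `stuck-missing`: `no-common-isolates` leaves `a` or `b` without
    -- neighbours, and the 1 + 2m non-edges at that vertex are all there are, so the rest is a
    -- clique.
    stuck-tight : ∀ M → All Edge M → Stuck p M → 2 ≤ length M → missing (flat (p ∷ M)) ≤ 1 + 2 * length M →
                  ∃₂ λ w K → flat (p ∷ M) ↭ w ∷ K × deg w K ≡ 0 × missing K ≡ 0
    stuck-tight M es st 2≤m le = conclude (no-common-isolates T P Q (length M) 2≤m
      (≤-by 0 (+-mono-≤ (central M 0 st es (forced+0≤missing M es st)) le) (eq (length M) (missing (flat (p ∷ M))) (weight M) (forced T P Q)))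
      (weight≤ M es st))
      where
      T = ∑ tw M ; P = ∑ pw M ; Q = ∑ qw M
      eq : ∀ m μ S F → F + 2 * m + (μ + S + (1 + 2 * m)) + 0 ≡ 1 + 4 * m + (F + 0) + μ + S
      eq = solve-∀
      ab : A a b ≡ false
      ab = stuck₀ (Stuck-prefix [] es st)
      isolated : ∀ x y → flat (p ∷ M) ↭ x ∷ y ∷ flat M → A x y ≡ false → deg x (flat M) ≡ 0 →
                 ∃₂ λ w K → flat (p ∷ M) ↭ w ∷ K × deg w K ≡ 0 × missing K ≡ 0
      isolated x y σ xy d≡0 = x , y ∷ flat M , σ , d≡0′ , isolated-head x (y ∷ flat M) d≡0′
        (≤-trans (≤-reflexive (sym (missing-↭ σ))) (≤-trans le (≤-reflexive (cong suc (sym (flat-length M))))))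
        where
        d≡0′ : deg x (y ∷ flat M) ≡ 0
        d≡0′ = cong₂ _+_ (cong ind xy) d≡0
      conclude : T + P ≡ 0 ⊎ T + Q ≡ 0 → ∃₂ λ w K → flat (p ∷ M) ↭ w ∷ K × deg w K ≡ 0 × missing K ≡ 0
      conclude (inj₁ eq) = isolated a b refl ab (≡.trans (deg-left M) eq)
      conclude (inj₂ eq) = isolated b a (swap a b refl) (≡.trans (A-sym b a) ab) (≡.trans (deg-right M) eq)

    -- As `f` adds nothing to T, P and Q, the edges other than `f` already account for `forced`. The
    -- two non-edges between `f` and two common edges, found by `two-common`, come on top.
    bonus : ∀ M f M′ → M ↭ f ∷ M′ → tw f + pw f + qw f ≡ 0 → 2 ≤ ∑ tw M → All Edge M → Stuck p M →
            forced (∑ tw M) (∑ pw M) (∑ qw M) + 2 ≤ missing (flat M)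
    bonus M f M′ σ f≡0 2≤T es st
      with extract (∑-pos tw M′ (≤-trans (s≤s z≤n) (subst (2 ≤_) T≡ 2≤T)))
      where
      T≡ : ∑ tw M ≡ ∑ tw M′
      T≡ = ≡.trans (∑-↭ tw σ) (cong (_+ ∑ tw M′) (m+n≡0⇒m≡0 (tw f) (m+n≡0⇒m≡0 (tw f + pw f) f≡0)))
    -- The edge `e₁` accounts for at most one unit of T ≥ 2 and `f` for none, so a second common
    -- edge remains.
    ... | e₁ , M₁ , σ₁ , t₁ with extract (∑-pos tw M₁ (≤-pred (≤-trans (subst (2 ≤_) T≡ 2≤T) (+-monoˡ-≤ (∑ tw M₁) (tw≤1 e₁)))))
      where
      T≡ : ∑ tw M ≡ tw e₁ + ∑ tw M₁
      T≡ = ≡.trans (∑-↭ tw σ) (≡.trans (cong (_+ ∑ tw M′) (m+n≡0⇒m≡0 (tw f) (m+n≡0⇒m≡0 (tw f + pw f) f≡0))) (∑-↭ tw σ₁))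
    ... | e₂ , M₂ , σ₂ , t₂ = begin
      forced (∑ tw M) (∑ pw M) (∑ qw M) + 2
        ≡⟨ cong (_+ 2) (cong₃ forced (same tw (m+n≡0⇒m≡0 (tw f) (m+n≡0⇒m≡0 (tw f + pw f) f≡0)))
                                     (same pw (m+n≡0⇒n≡0 (tw f) (m+n≡0⇒m≡0 (tw f + pw f) f≡0)))
                                     (same qw (m+n≡0⇒n≡0 (tw f + pw f) f≡0))) ⟩
      forced (∑ tw N) (∑ pw N) (∑ qw N) + 2
        ≤⟨ +-mono-≤ (forced≤missing N es-N (Stuck-tail edge-f st′)) (two-common f e₁ e₂ t₁ t₂ (Stuck-prefix _ es₂ st′)) ⟩
      missing (flat N) + (across f e₁ + across f e₂)
        ≤⟨ m≤m+n _ (∑ (across f) M₂) ⟩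
      missing (flat N) + (across f e₁ + across f e₂) + ∑ (across f) M₂
        ≡⟨ rearrange (missing (flat N)) (across f e₁) (across f e₂) (∑ (across f) M₂) ⟩
      ∑ (across f) N + missing (flat N)
        ≡⟨ cong (_+ (∑ (across f) N + missing (flat N))) (gap-edge f edge-f) ⟨
      gap′ f + (∑ (across f) N + missing (flat N))
        ≡⟨ missing-flat f N ⟨
      missing (flat (f ∷ N))
        ≡⟨ missing-↭ (flat-↭ τ) ⟨
      missing (flat M) ∎
      where
      open ≤-Reasoning
      N = e₁ ∷ e₂ ∷ M₂
      τ : M ↭ f ∷ N
      τ = trans σ (prep f (trans σ₁ (prep e₁ σ₂)))
      st′ : Stuck p (f ∷ N)
      st′ = Stuck-↭ τ st
      es′ : All Edge (f ∷ N)
      es′ = All-resp-↭ τ es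
      edge-f : Edge f
      edge-f = All.head es′
      es-N : All Edge N
      es-N = All.tail es′
      es₂ : All Edge M₂
      es₂ = All.tail (All.tail es-N)
      same : ∀ (g : Pair → ℕ) → g f ≡ 0 → ∑ g M ≡ ∑ g N
      same g eq = ≡.trans (∑-↭ g τ) (cong (_+ ∑ g N) eq)
      cong₃ : ∀ (h : ℕ → ℕ → ℕ → ℕ) {x x′ y y′ z z′} → x ≡ x′ → y ≡ y′ → z ≡ z′ → h x y z ≡ h x′ y′ z′
      cong₃ h refl refl refl = refl
      rearrange : ∀ μ x y z → μ + (x + y) + z ≡ x + (y + z) + μ
      rearrange = solve-∀

    -- An edge that misses both neighbourhoods would give two more non-edges by `bonus`, against
    -- `¬Slack-2`. So every edge contributes to T + P + Q, which yields the bound `m≤` required by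
    -- `extremal`.
    all-common : ∀ M → All Edge M → Stuck p M → 2 ≤ deg a (flat M) → 2 ≤ deg b (flat M) →
                 Sparse (length M) (missing (flat (p ∷ M))) →
                 ∑ tw M ≡ length M × missing (flat (p ∷ M)) ≤ tri (2 + length M) × length M ≤ 4
    all-common M es st da db sp = extremal {R = ∑ pw M + ∑ qw M} sp T≤m m≤ (λ s → slk s 0 (forced+0≤missing M es st))
      where
      m = length M
      T = ∑ tw M ; P = ∑ pw M ; Q = ∑ qw M
      μ = missing (flat (p ∷ M))
      F = forced T P Q
      eq : ∀ m F d μ S s → F + (2 + (d + s)) + (μ + S + 4 * m) + 0 ≡ 1 + 4 * m + (F + d) + (suc μ + s) + S
      eq = solve-∀
      slk : ∀ s d → F + d ≤ missing (flat M) → suc μ + s ≤ 4 * m → Slack T (P + Q) (d + s)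
      slk s d le le′ = slack T P Q (d + s) (subst (2 ≤_) (deg-left M) da) (subst (2 ≤_) (deg-right M) db)
        (≤-by 0 (+-mono-≤ (central M d st es le) le′) (eq m F d μ (weight M) s))
      strict : suc μ + 0 ≤ 4 * m
      strict = ≤-trans (≤-reflexive (+-identityʳ (suc μ))) (sparse-strict sp)
      T≤m : T ≤ m
      T≤m = ≤-trans (∑-mono (All.universal tw≤1 M)) (≤-reflexive (≡.trans (∑-const 1 M) (*-identityʳ m)))
      m≤ : m ≤ T + (P + Q)
      m≤ with any? (λ e → tw e + pw e + qw e ≟ 0) M
      ... | yes i = let f , M′ , σ , f≡0 = extract i in
        ⊥-elim (¬Slack-2 {T} {P + Q} (slk 0 2 (bonus M f M′ σ f≡0 (Slack⇒2≤T {T} {P + Q} {0} (slk 0 0 (forced+0≤missing M es st) strict)) es st) strict))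
      ... | no ¬i = begin
        m                                   ≡⟨ ≡.trans (∑-const 1 M) (*-identityʳ m) ⟨
        ∑ (λ _ → 1) M                       ≤⟨ ∑-mono (All.map n≢0⇒n>0 (AllP.¬Any⇒All¬ M ¬i)) ⟩
        ∑ (λ e → tw e + pw e + qw e) M      ≡⟨ ∑-+ (λ e → tw e + pw e) qw M ⟩
        ∑ (λ e → tw e + pw e) M + Q         ≡⟨ cong (_+ Q) (∑-+ tw pw M) ⟩
        T + P + Q                           ≡⟨ +-assoc T P Q ⟩
        T + (P + Q)                         ∎
        where open ≤-Reasoning

    orient : ∀ M → All Edge M → Stuck p M → All (λ e → 1 ≤ tw e) M →
             ∃ λ N → flat N ↭ flat M × length N ≡ length M × All Edge N × All Hub N
    orient []      []           st []       = [] , refl , refl , [] , []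
    orient (e ∷ M) (edge ∷ es) st (t ∷ ts) with orient M es (Stuck-tail edge st) ts | hub e t
    ... | N , σ , len , es′ , hs | inj₁ h =
      e ∷ N , prep (proj₁ e) (prep (proj₂ e) σ) , cong suc len , edge ∷ es′ , h ∷ hs
    ... | N , σ , len , es′ , hs | inj₂ h =
      flip e ∷ N , swap (proj₂ e) (proj₁ e) σ , cong suc len , Edge-flip edge ∷ es′ , h ∷ hs

    flat-unzip : ∀ M → flat M ↭ map proj₁ M ++ map proj₂ M
    flat-unzip []            = refl
    flat-unzip ((x , y) ∷ M) =
      prep x (trans (prep y (flat-unzip M)) (↭-sym (shift y (map proj₁ M) (map proj₂ M))))

    hub-isolated : ∀ {x y} → Hub (x , y) → Stuck p ((x , y) ∷ []) → A a y ≡ false × A b y ≡ false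
    hub-isolated {x} {y} (ax , bx) st =
      ≢true⇒≡false (λ ay → true≢false (≡.trans (sym (cong₂ _∧_ bx ay)) (stuck₁ (Stuck-flip st)))) ,
      ≢true⇒≡false (λ by → true≢false (≡.trans (sym (cong₂ _∧_ ax by)) (stuck₁ st)))

    -- Otherwise a, x, y, w, z, b would be an augmenting path of length 5.
    hubs-isolated : ∀ {x y z w} → Hub (x , y) → Hub (z , w) → Stuck p ((x , y) ∷ (z , w) ∷ []) → A y w ≡ false
    hubs-isolated {x} {y} {z} {w} (ax , _) (_ , bz) st =
      ≢true⇒≡false (λ yw → true≢false (≡.trans (sym (cong₂ _∧_ ax (cong₂ _∧_ yw bz))) (stuck₂ (Stuck-flip-second st))))

    leaves-independent : ∀ M → All Edge M → All Hub M → Stuck p M →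
      All (λ y → A a y ≡ false × A b y ≡ false) (map proj₂ M) × None-Adj (map proj₂ M)
    leaves-independent []      []          []       st = [] , []
    leaves-independent (e ∷ M) (edge ∷ es) (h ∷ hs) st with leaves-independent M es hs (Stuck-tail edge st)
    ... | l , n = hub-isolated h (Stuck-prefix (e ∷ []) es st) ∷ l , row M es hs st ∷ n
      where
      row : ∀ M → All Edge M → All Hub M → Stuck p (e ∷ M) → All (λ y → A (proj₂ e) y ≡ false) (map proj₂ M)
      row []      []          []       st = []
      row (f ∷ M) (edge′ ∷ es) (k ∷ hs) st =
        hubs-isolated h k (Stuck-prefix (e ∷ f ∷ []) es st) ∷ row M es hs (Stuck-tail edge′ (Stuck-↭ (swap e f refl) st))

    -- `X` collects the common neighbours, one from each matching edge; `I` consists of `a`, `b` and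
    -- the other ends, and is independent because paths of length 1, 3 and 5 are excluded.
    independent-join : ∀ M → All Edge M → Stuck p M → 2 ≤ deg a (flat M) → 2 ≤ deg b (flat M) →
      Sparse (length M) (missing (flat (p ∷ M))) →
      ∃₂ λ X I → flat (p ∷ M) ↭ X ++ I × length X ≡ length M × length I ≡ 2 + length M ×
                 All-Adj X × Joined X I × None-Adj I × length M ≤ 4
    independent-join M es st da db sp with all-common M es st da db sp
    ... | T≡m , μ≤ , m≤4 with orient M es st (full M T≡m)
      where
      full : ∀ M → ∑ tw M ≡ length M → All (λ e → 1 ≤ tw e) M
      full M eq = All.map (λ {e} 1∸t≡0 → m∸n≡0⇒m≤n 1∸t≡0) (∑≡0⇒All (λ e → 1 ∸ tw e) M (+-cancelˡ-≡ (∑ tw M) _ _ (begin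
        ∑ tw M + ∑ (λ e → 1 ∸ tw e) M   ≡⟨ ∑-+ tw (λ e → 1 ∸ tw e) M ⟨
        ∑ (λ e → tw e + (1 ∸ tw e)) M   ≡⟨ ∑-cong (All.universal (λ e → m+[n∸m]≡n (tw≤1 e)) M) ⟩
        ∑ (λ _ → 1) M                   ≡⟨ ∑-const 1 M ⟩
        length M * 1                    ≡⟨ *-identityʳ (length M) ⟩
        length M                        ≡⟨ eq ⟨
        ∑ tw M                          ≡⟨ +-identityʳ (∑ tw M) ⟨
        ∑ tw M + 0                      ∎)))
        where open ≡-Reasoning
    ... | N , σ , len , es′ , hs =
      X , I , τ , ≡.trans (length-map proj₁ N) len , length-I , missing≡0 X (m+n≡0⇒m≡0 _ excess≡0) ,
      between≡0 X I (m+n≡0⇒n≡0 (missing X) excess≡0) , none , m≤4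
      where
      X = map proj₁ N
      I = a ∷ b ∷ map proj₂ N
      τ : flat (p ∷ M) ↭ X ++ I
      τ = trans (prep a (prep b (trans (↭-sym σ) (flat-unzip N))))
            (++-rotate X (map proj₂ N))
        where
        ++-rotate : ∀ X Y → a ∷ b ∷ X ++ Y ↭ X ++ a ∷ b ∷ Y
        ++-rotate X Y = trans (prep a (↭-sym (shift b X Y))) (↭-sym (shift a X (b ∷ Y)))
      length-I : length I ≡ 2 + length M
      length-I = cong (2 +_) (≡.trans (length-map proj₂ N) len)
      st′ : Stuck p N
      st′ m = st (Matchable-↭ (prep a (prep b σ)) m)
      none : None-Adj I
      none with leaves-independent N es′ hs st′
      ... | l , n = (stuck₀ (Stuck-prefix [] es st) ∷ All.map proj₁ l) ∷ All.map proj₂ l ∷ n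
      -- The non-edges inside `I` already exhaust the bound `μ≤`, so none is left within `X` or
      -- between `X` and `I`.
      excess≡0 : missing X + between X I ≡ 0
      excess≡0 = n≤0⇒n≡0 (+-cancelʳ-≤ (missing I) (missing X + between X I) 0 (begin
        missing X + between X I + missing I   ≡⟨ +-assoc (missing X) _ _ ⟩
        missing X + (between X I + missing I) ≡⟨ missing-++ X I ⟨
        missing (X ++ I)                      ≡⟨ missing-↭ τ ⟨
        missing (flat (p ∷ M))                ≤⟨ μ≤ ⟩
        tri (2 + length M)                    ≡⟨ cong tri length-I ⟨
        tri (length I)                        ≡⟨ missing-independent none ⟨
        missing I                             ∎))
        where open ≤-Reasoning

-- Switching until only one pair is a non-edge.

module NearPerfect {V : Set} (A : V → V → Bool) (A-sym : ∀ x y → A x y ≡ A y x) where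
  open Matchings A A-sym

  -- Two pairs can be re-paired crosswise in two disjoint ways; a single non-edge between them
  -- spoils at most one of these.
  rematch : ∀ p f → across p f ≤ 1 → ∃₂ λ g h → Edge g × Edge h × (∀ R → flat (g ∷ h ∷ R) ↭ flat (p ∷ f ∷ R))
  rematch (a , b) (x , y) le with A a x in ax | A a y in ay | A b x in bx | A b y in by
  ... | true  | _     | _     | true  = (a , x) , (b , y) , ax , by , λ R → prep a (swap x b refl)
  ... | true  | true  | true  | false = (a , y) , (b , x) , ay , bx , λ R → prep a (trans (shift b (y ∷ []) (x ∷ flat R)) (prep b (swap y x refl)))
  ... | false | true  | true  | _     = (a , y) , (b , x) , ay , bx , λ R → prep a (trans (shift b (y ∷ []) (x ∷ flat R)) (prep b (swap y x refl)))
  ... | true  | false | true  | false with s≤s () ← le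
  ... | true  | true  | false | false with s≤s () ← le
  ... | true  | false | false | false with s≤s () ← le
  ... | false | true  | false | true  with s≤s () ← le
  ... | false | true  | false | false with s≤s () ← le
  ... | false | false | true  | true  with s≤s () ← le
  ... | false | false | true  | false with s≤s () ← le
  ... | false | false | false | true  with s≤s () ← le
  ... | false | false | false | false with s≤s () ← le

  improve : ∀ {M p f R} → M ↭ p ∷ f ∷ R → 1 ≤ gap′ p → across p f ≤ 1 →
            ∃ λ N → flat N ↭ flat M × length N ≡ length M × suc (∑ gap′ N) ≤ ∑ gap′ M
  improve {M} {p} {f} {R} σ p≥1 le with rematch p f le
  ... | g , h , edge-g , edge-h , τ =
    g ∷ h ∷ R , trans (τ R) (flat-↭ (↭-sym σ)) , sym (↭-length σ) , (begin
      suc (gap′ g + (gap′ h + ∑ gap′ R)) ≡⟨ cong₂ (λ i j → suc (i + (j + ∑ gap′ R))) (gap-edge g edge-g) (gap-edge h edge-h) ⟩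
      1 + ∑ gap′ R                       ≤⟨ +-mono-≤ p≥1 (m≤n+m (∑ gap′ R) (gap′ f)) ⟩
      gap′ p + (gap′ f + ∑ gap′ R)       ≡⟨ ∑-↭ gap′ σ ⟨
      ∑ gap′ M                           ∎)
    where open ≤-Reasoning

  ¬gap⇒Edge : ∀ {e} → ¬ (1 ≤ gap′ e) → Edge e
  ¬gap⇒Edge {x , y} ¬le with A x y
  ... | true  = refl
  ... | false = ⊥-elim (¬le ≤-refl)

  across≥2 : ∀ e R → ¬ Any (λ f → across e f ≤ 1) R → 2 * length R ≤ ∑ (across e) R
  across≥2 e R ¬i = begin
    2 * length R   ≡⟨ *-comm 2 (length R) ⟩
    length R * 2   ≡⟨ ∑-const 2 R ⟨
    ∑ (λ _ → 2) R  ≤⟨ ∑-mono (All.map ≰⇒> (AllP.¬Any⇒All¬ R ¬i)) ⟩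
    ∑ (across e) R ∎
    where open ≤-Reasoning

  -- If no switch helps, there are at least two non-edges from `p` to each other pair and from `q`
  -- to each pair of `R`; `p` and `q` themselves are two more.
  two-gaps : ∀ {p q} R → 1 ≤ gap′ p → 1 ≤ gap′ q → ¬ Any (λ f → across p f ≤ 1) (q ∷ R) →
             ¬ Any (λ f → across q f ≤ 1) R → 4 + 4 * length R ≤ missing (flat (p ∷ q ∷ R))
  two-gaps {p} {q} R p≥1 q≥1 ¬p ¬q = begin
    4 + 4 * length R
      ≡⟨ rearrange (length R) ⟩
    1 + (2 * length (q ∷ R) + (1 + (2 * length R + 0)))
      ≤⟨ +-mono-≤ p≥1 (+-mono-≤ (across≥2 p (q ∷ R) ¬p) (+-mono-≤ q≥1 (+-mono-≤ (across≥2 q R ¬q) z≤n))) ⟩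
    gap′ p + (∑ (across p) (q ∷ R) + (gap′ q + (∑ (across q) R + missing (flat R))))
      ≡⟨ cong (λ s → gap′ p + (∑ (across p) (q ∷ R) + s)) (missing-flat q R) ⟨
    gap′ p + (∑ (across p) (q ∷ R) + missing (flat (q ∷ R)))
      ≡⟨ missing-flat p (q ∷ R) ⟨
    missing (flat (p ∷ q ∷ R)) ∎
    where
    open ≤-Reasoning
    rearrange : ∀ r → 4 + 4 * r ≡ 1 + (2 * suc r + (1 + (2 * r + 0)))
    rearrange = solve-∀

  NearPerfect : List Pair → Set
  NearPerfect M = ∃₂ λ p N → flat (p ∷ N) ↭ flat M × All Edge N × suc (length N) ≡ length M

  -- The recursion is on a bound k for the number of non-edges in the pairing, which each switch lowers.
  near-perfect : ∀ k M → ∑ gap′ M ≤ k → ¬ Matchable (flat M) → 5 + missing (flat M) ≤ 4 * length M → NearPerfect M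
  near-perfect k M bad≤ ¬m h with any? (λ e → 1 ≤? gap′ e) M
  ... | no ¬i = ⊥-elim (¬m (M , refl , All.map ¬gap⇒Edge (AllP.¬Any⇒All¬ M ¬i)))
  ... | yes i with extract i
  ... | p , M′ , σ , p≥1 with any? (λ e → 1 ≤? gap′ e) M′
  ... | no ¬j = p , M′ , flat-↭ (↭-sym σ) , All.map ¬gap⇒Edge (AllP.¬Any⇒All¬ M′ ¬j) , sym (↭-length σ)
  ... | yes j with extract j
  ... | q , R , τ , q≥1 = search (any? (λ f → across p f ≤? 1) (q ∷ R)) (any? (λ f → across q f ≤? 1) R)
    where
    M↭pqR : M ↭ p ∷ q ∷ R
    M↭pqR = trans σ (prep p τ)
    retry : ∀ k → ∑ gap′ M ≤ k →
            (∃ λ N → flat N ↭ flat M × length N ≡ length M × suc (∑ gap′ N) ≤ ∑ gap′ M) → NearPerfect M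
    retry zero    bad≤ (N , ρ , len , better) = ⊥-elim (n≮0 (≤-trans better bad≤))
    retry (suc k) bad≤ (N , ρ , len , better)
      with near-perfect k N (≤-pred (≤-trans better bad≤)) (λ m → ¬m (Matchable-↭ ρ m))
             (subst (λ s → 5 + s ≤ 4 * length N) (sym (missing-↭ ρ)) (subst (λ l → 5 + missing (flat M) ≤ 4 * l) (sym len) h))
    ... | p′ , N′ , ρ′ , es , len′ = p′ , N′ , trans ρ′ ρ , es , ≡.trans len′ len
    search : Dec (Any (λ f → across p f ≤ 1) (q ∷ R)) → Dec (Any (λ f → across q f ≤ 1) R) → NearPerfect M
    search (yes i) _ with extract i
    ... | f , R′ , ρ , le = retry k bad≤ (improve (trans M↭pqR (prep p ρ)) p≥1 le)
    search (no _) (yes i) with extract i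
    ... | f , R′ , ρ , le = retry k bad≤ (improve (trans M↭pqR (trans (swap p q ρ) (prep q (swap p f refl)))) q≥1 le)
    -- With r further pairs, `two-gaps` gives at least 4 + 4r non-edges, whereas the hypothesis `h`
    -- permits 4(2 + r) - 5 = 3 + 4r.
    search (no ¬i) (no ¬j) = ⊥-elim (n≮n (4 * length M) (begin-strict
      4 * length M                       ≡⟨ cong (4 *_) (↭-length M↭pqR) ⟩
      4 * (2 + length R)                 ≡⟨ rearrange (length R) ⟩
      4 + (4 + 4 * length R)             <⟨ +-monoʳ-≤ 5 (two-gaps R p≥1 q≥1 ¬i ¬j) ⟩
      5 + missing (flat (p ∷ q ∷ R))     ≡⟨ cong (5 +_) (missing-↭ (flat-↭ M↭pqR)) ⟨
      5 + missing (flat M)               ≤⟨ h ⟩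
      4 * length M                       ∎))
      where
      open ≤-Reasoning
      rearrange : ∀ r → 4 * (2 + r) ≡ 4 + (4 + 4 * r)
      rearrange = solve-∀

-- Counting edges and non-edges of a graph.

lookup-All : ∀ {X : Set} {P : X → Set} {L} → All P L → ∀ i → P (Vec.lookup (Vec.fromList L) i)
lookup-All (p ∷ ps) Fin.zero    = p
lookup-All (p ∷ ps) (Fin.suc i) = lookup-All ps i

AllPairs-resp-↭ : ∀ {X : Set} {R : X → X → Set} → Symmetric R → ∀ {L L'} → L ↭ L' → AllPairs R L → AllPairs R L'
AllPairs-resp-↭ {X} {R} R-sym σ = SetoidPerm.AllPairs-resp-↭ (setoid X) R-sym (resp₂ R) (↭⇒↭ₛ σ)

Unique-resp-↭ : ∀ {X : Set} {L L' : List X} → L ↭ L' → Unique L → Unique L'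
Unique-resp-↭ = AllPairs-resp-↭ (λ x≢y → x≢y ∘ sym)

countTrue-map : ∀ {X : Set} (f : X → Bool) L → countTrue (map f L) ≡ ∑ (λ x → ind (f x)) L
countTrue-map f []      = refl
countTrue-map f (x ∷ L) with f x
... | true  = cong suc (countTrue-map f L)
... | false = countTrue-map f L

countTrue-++ : ∀ bs cs → countTrue (bs ++ cs) ≡ countTrue bs + countTrue cs
countTrue-++ []           cs = refl
countTrue-++ (true ∷ bs)  cs = cong suc (countTrue-++ bs cs)
countTrue-++ (false ∷ bs) cs = countTrue-++ bs cs

countTrue-concatMap : ∀ {X : Set} (f : X → List Bool) L → countTrue (concatMap f L) ≡ ∑ (countTrue ∘ f) L
countTrue-concatMap f []      = refl
countTrue-concatMap f (x ∷ L) = ≡.trans (countTrue-++ (f x) (concatMap f L)) (cong (countTrue (f x) +_) (countTrue-concatMap f L))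

∑-map : ∀ {X Y : Set} (g : Y → ℕ) (f : X → Y) L → ∑ g (map f L) ≡ ∑ (g ∘ f) L
∑-map g f L = cong sum (sym (map-∘ L))

∑-ext : ∀ {X : Set} {g h : X → ℕ} → g ≗ h → ∀ L → ∑ g L ≡ ∑ h L
∑-ext eq L = ∑-cong (All.universal eq L)

missing-map : ∀ {V W : Set} (A : V → V → Bool) A-sym (f : W → V) (L : List W) →
  Matchings.missing A A-sym (map f L) ≡ Matchings.missing (A on f) (λ x y → A-sym (f x) (f y)) L
missing-map A A-sym f []      = refl
missing-map A A-sym f (x ∷ L) = cong₂ _+_ (∑-map (λ y → ind (not (A (f x) y))) f L) (missing-map A A-sym f L)

allFin-suc : ∀ n → allFin (suc n) ≡ Fin.zero ∷ map Fin.suc (allFin n)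
allFin-suc n = cong (Fin.zero ∷_) (sym (map-tabulate (λ i → i) Fin.suc))

length-allFin : ∀ n → length (allFin n) ≡ n
length-allFin n = length-tabulate (λ i → i)

upper : ∀ {n} → (Fin n → Fin n → Bool) → ℕ
upper {n} A = ∑ (λ i → ∑ (λ j → ind (A i j ∧ (toℕ i <ᵇ toℕ j))) (allFin n)) (allFin n)

numEdges≡upper : ∀ {n} (G : Graph n) → numEdges G ≡ upper (adj G)
numEdges≡upper {n} G = ≡.trans (countTrue-concatMap _ (allFin n)) (∑-ext (λ i → countTrue-map _ (allFin n)) (allFin n))

upper-suc : ∀ {n} (A : Fin (suc n) → Fin (suc n) → Bool) →
  upper A ≡ ∑ (λ j → ind (A Fin.zero (Fin.suc j))) (allFin n) + upper (A on Fin.suc)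
upper-suc {n} A = cong₂ _+_
  (≡.trans (cong₂ _+_ (cong ind (∧-zeroʳ (A Fin.zero Fin.zero))) (∑-suc _))
    (∑-ext (λ j → cong ind (∧-identityʳ (A Fin.zero (Fin.suc j)))) (allFin n)))
  (≡.trans (∑-suc _)
    (∑-ext (λ i → cong₂ _+_ (cong ind (∧-zeroʳ (A (Fin.suc i) Fin.zero))) (∑-suc _)) (allFin n)))
  where
  ∑-suc : ∀ (g : Fin (suc n) → ℕ) → ∑ g (tabulate Fin.suc) ≡ ∑ (λ i → g (Fin.suc i)) (allFin n)
  ∑-suc g = ≡.trans (cong (∑ g) (sym (map-tabulate (λ i → i) Fin.suc))) (∑-map g Fin.suc (allFin n))

-- Every pair of vertices is either an edge or a non-edge. The induction removes vertex 0, which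
-- lies in n pairs with the remaining vertices.
upper+missing : ∀ n (A : Fin n → Fin n → Bool) A-sym → upper A + Matchings.missing A A-sym (allFin n) ≡ tri n
upper+missing zero    A A-sym = refl
upper+missing (suc n) A A-sym = begin
  upper A + missing (allFin (suc n))
    ≡⟨ cong₂ _+_ (upper-suc A) (cong missing (allFin-suc n)) ⟩
  row + upper (A on Fin.suc) + (∑ (gap Fin.zero) (map Fin.suc (allFin n)) + missing (map Fin.suc (allFin n)))
    ≡⟨ cong (row + upper (A on Fin.suc) +_) (cong (∑ (gap Fin.zero) (map Fin.suc (allFin n)) +_) (missing-map A A-sym Fin.suc (allFin n))) ⟩
  row + upper (A on Fin.suc) + (∑ (gap Fin.zero) (map Fin.suc (allFin n)) + rest)
    ≡⟨ rearrange row (upper (A on Fin.suc)) (∑ (gap Fin.zero) (map Fin.suc (allFin n))) rest ⟩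
  row + ∑ (gap Fin.zero) (map Fin.suc (allFin n)) + (upper (A on Fin.suc) + rest)
    ≡⟨ cong₂ _+_ (cong (_+ ∑ (gap Fin.zero) (map Fin.suc (allFin n))) (sym (∑-map (λ j → ind (A Fin.zero j)) Fin.suc (allFin n))))
                 (upper+missing n (A on Fin.suc) (λ x y → A-sym (Fin.suc x) (Fin.suc y))) ⟩
  deg Fin.zero (map Fin.suc (allFin n)) + ∑ (gap Fin.zero) (map Fin.suc (allFin n)) + tri n
    ≡⟨ cong (_+ tri n) (≡.trans (deg+gaps Fin.zero (map Fin.suc (allFin n))) (≡.trans (length-map Fin.suc (allFin n)) (length-allFin n))) ⟩
  n + tri n ∎
  where
  open ≡-Reasoning
  open Matchings A A-sym
  row = ∑ (λ j → ind (A Fin.zero (Fin.suc j))) (allFin n)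
  rest = Matchings.missing (A on Fin.suc) (λ x y → A-sym (Fin.suc x) (Fin.suc y)) (allFin n)
  rearrange : ∀ a b c d → a + b + (c + d) ≡ a + c + (b + d)
  rearrange = solve-∀

tri≡C₂ : ∀ n → tri n ≡ n C 2
tri≡C₂ zero    = refl
tri≡C₂ (suc n) = ≡.trans (cong₂ _+_ (sym (nC1≡n n)) (tri≡C₂ n)) (nCk+nC[k+1]≡[n+1]C[k+1] n 1)

-- Perfect matchings and isomorphisms obtained from lists of vertices.

module _ {n : ℕ} (G : Graph n) where
  open Matchings (adj G) (adj-sym G)

  degree≡deg : ∀ i → degree G i ≡ deg i (allFin n)
  degree≡deg i = countTrue-map (adj G i) (allFin n)

  numEdges+missing : numEdges G + missing (allFin n) ≡ tri n
  numEdges+missing = ≡.trans (cong (_+ missing (allFin n)) (numEdges≡upper G)) (upper+missing n (adj G) (adj-sym G))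

  Mate : Fin n → Fin n → Pair → Set
  Mate i j e = (i ≡ proj₁ e × j ≡ proj₂ e) ⊎ (i ≡ proj₂ e × j ≡ proj₁ e)

  Mate-sym : ∀ {i j e} → Mate i j e → Mate j i e
  Mate-sym (inj₁ (eq , eq′)) = inj₂ (eq′ , eq)
  Mate-sym (inj₂ (eq , eq′)) = inj₁ (eq′ , eq)

  Mate-edge : ∀ {i j e} → Edge e → Mate i j e → adj G i j ≡ true
  Mate-edge {e = x , y} eq (inj₁ (refl , refl)) = eq
  Mate-edge {e = x , y} eq (inj₂ (refl , refl)) = ≡.trans (adj-sym G y x) eq

  mate : ∀ {i} M → i ∈ flat M → ∃ λ j → Any (Mate i j) M
  mate ((x , y) ∷ M) (here eq)          = y , here (inj₁ (eq , refl))
  mate ((x , y) ∷ M) (there (here eq))  = x , here (inj₂ (eq , refl))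
  mate ((x , y) ∷ M) (there (there i∈)) = let j , p = mate M i∈ in j , there p

  mate-∈ : ∀ {i j} M → Any (Mate i j) M → i ∈ flat M
  mate-∈ (e ∷ M) (here (inj₁ (eq , _))) = here eq
  mate-∈ (e ∷ M) (here (inj₂ (eq , _))) = there (here eq)
  mate-∈ (e ∷ M) (there p)              = there (there (mate-∈ M p))

  mate-unique : ∀ {i j k} M → Unique (flat M) → Any (Mate i j) M → Any (Mate i k) M → j ≡ k
  mate-unique ((x , y) ∷ M) ((x≢y ∷ x∉) ∷ y∉ ∷ uniq) = λ where
    (here (inj₁ (refl , refl))) (here (inj₁ (refl , refl))) → refl
    (here (inj₁ (refl , refl))) (here (inj₂ (eq , _)))      → ⊥-elim (x≢y eq)
    (here (inj₂ (refl , refl))) (here (inj₁ (eq , _)))      → ⊥-elim (x≢y (sym eq))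
    (here (inj₂ (refl , refl))) (here (inj₂ (refl , refl))) → refl
    (here (inj₁ (refl , refl))) (there q) → ⊥-elim (All.lookup x∉ (mate-∈ M q) refl)
    (here (inj₂ (refl , refl))) (there q) → ⊥-elim (All.lookup y∉ (mate-∈ M q) refl)
    (there q) (here (inj₁ (refl , refl))) → ⊥-elim (All.lookup x∉ (mate-∈ M q) refl)
    (there q) (here (inj₂ (refl , refl))) → ⊥-elim (All.lookup y∉ (mate-∈ M q) refl)
    (there p) (there q) → mate-unique M uniq p q

  mate-edge : ∀ {i j M} → All Edge M → Any (Mate i j) M → adj G i j ≡ true
  mate-edge (edge ∷ es) (here m)  = Mate-edge edge m
  mate-edge (edge ∷ es) (there p) = mate-edge es p

  -- Each vertex occurs exactly once in `flat M`, so it has one mate there; the partner map is an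
  -- involution because being mates is symmetric and mates are unique.
  Matchable⇒PerfectMatching : Matchable (allFin n) → PerfectMatching G
  Matchable⇒PerfectMatching (M , σ , es) = record
    { partner       = λ i → proj₁ (m i)
    ; partner-edge  = λ i → mate-edge es (proj₂ (m i))
    ; partner-invol = λ i → mate-unique M (Unique-resp-↭ (↭-sym σ) (allFin⁺ n)) (proj₂ (m (proj₁ (m i))))
                              (Any-map (λ {e} → Mate-sym {e = e}) (proj₂ (m i)))
    }
    where
    m : ∀ i → ∃ λ j → Any (Mate i j) M
    m i = mate M (∈-resp-↭ (↭-sym σ) (∈-allFin i))

  search : ∀ {m} {P : Vec (Fin n) m → Set} → (∀ w → Dec (P w)) → Dec (∃ P)
  search {zero}  P? = map′ (Vec.[] ,_) (λ { (Vec.[] , p) → p }) (P? Vec.[])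
  search {suc m} P? = map′ (λ (x , w , p) → x Vec.∷ w , p) (λ { (x Vec.∷ w , p) → x , w , p })
                        (Fin-any? (λ x → search (λ w → P? (x Vec.∷ w))))

  -- Needed so that `excludable` can split constructively on whether the edge-deleted graph has a
  -- perfect matching. Partner maps are represented by vectors, of which there are finitely many.
  perfectMatching? : Dec (PerfectMatching G)
  perfectMatching? = map′ from to (search {n} λ w → all? λ i →
    (adj G i (Vec.lookup w i) Bool.≟ true) ×-dec (Vec.lookup w (Vec.lookup w i) Fin.≟ i))
    where
    from : (∃ λ w → ∀ i → adj G i (Vec.lookup w i) ≡ true × Vec.lookup w (Vec.lookup w i) ≡ i) → PerfectMatching G
    from (w , h) = record { partner = Vec.lookup w ; partner-edge = proj₁ ∘ h ; partner-invol = proj₂ ∘ h }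
    to : PerfectMatching G → ∃ λ w → ∀ i → adj G i (Vec.lookup w i) ≡ true × Vec.lookup w (Vec.lookup w i) ≡ i
    to record { partner = f ; partner-edge = f-edge ; partner-invol = f-invol } = Vec.tabulate f , λ i →
      ≡.trans (cong (adj G i) (lookup∘tabulate f i)) (f-edge i) ,
      ≡.trans (lookup∘tabulate f _) (≡.trans (cong f (lookup∘tabulate f i)) (f-invol i))

  Realizes : ∀ {m} → Graph m → Vec (Fin n) m → Set
  Realizes H w = ∀ i j → adj H i j ≡ adj G (Vec.lookup w i) (Vec.lookup w j)

  sumGraph-realizes : ∀ {a b} {H : Graph a} {K : Graph b} {x : Vec (Fin n) a} {y : Vec (Fin n) b} c →
    (∀ i j → adj G (Vec.lookup x i) (Vec.lookup y j) ≡ c) →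
    Realizes H x → Realizes K y → Realizes (sumGraph c H K) (x Vec.++ y)
  sumGraph-realizes {a} {H = H} {K} {x} {y} c cross rH rK i j
    rewrite lookup-splitAt a x y i | lookup-splitAt a x y j with splitAt a i | splitAt a j
  ... | inj₁ i′ | inj₁ j′ = rH i′ j′
  ... | inj₁ i′ | inj₂ j′ = sym (cross i′ j′)
  ... | inj₂ i′ | inj₁ j′ = sym (≡.trans (adj-sym G _ _) (cross j′ i′))
  ... | inj₂ i′ | inj₂ j′ = rK i′ j′

  complete-realizes : ∀ {L} → AllPairs (λ x y → adj G x y ≡ true) L → Realizes (complete (length L)) (Vec.fromList L)
  complete-realizes {x ∷ L} (e ∷ es) Fin.zero    Fin.zero    = sym (adj-irr G x)
  complete-realizes {x ∷ L} (e ∷ es) Fin.zero    (Fin.suc j) = sym (lookup-All e j)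
  complete-realizes {x ∷ L} (e ∷ es) (Fin.suc i) Fin.zero    = sym (≡.trans (adj-sym G _ x) (lookup-All e i))
  complete-realizes {x ∷ L} (e ∷ es) (Fin.suc i) (Fin.suc j) = complete-realizes es i j

  edgeless-realizes : ∀ {L} → AllPairs (λ x y → adj G x y ≡ false) L → Realizes (edgeless (length L)) (Vec.fromList L)
  edgeless-realizes {x ∷ L} (e ∷ es) Fin.zero    Fin.zero    = sym (adj-irr G x)
  edgeless-realizes {x ∷ L} (e ∷ es) Fin.zero    (Fin.suc j) = sym (lookup-All e j)
  edgeless-realizes {x ∷ L} (e ∷ es) (Fin.suc i) Fin.zero    = sym (≡.trans (adj-sym G _ x) (lookup-All e i))
  edgeless-realizes {x ∷ L} (e ∷ es) (Fin.suc i) (Fin.suc j) = edgeless-realizes es i j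

  -- The vector `w` lists every vertex exactly once, so taking the position in `w` is a bijection
  -- inverse to lookup.
  realizes⇒≅ : ∀ {m} {H : Graph m} (w : Vec (Fin n) m) → Vec.toList w ↭ allFin n → Realizes H w → G ≅ H
  realizes⇒≅ {m} {H} w σ r = mk↔ₛ′ pos (Vec.lookup w) pos-lookup lookup-pos , λ i j →
    ≡.trans (r (pos i) (pos j)) (cong₂ (adj G) (lookup-pos i) (lookup-pos j))
    where
    pos : Fin n → Fin m
    pos i = VecAny.index (∈-toList⁻ (∈-resp-↭ (↭-sym σ) (∈-allFin i)))
    lookup-pos : ∀ i → Vec.lookup w (pos i) ≡ i
    lookup-pos i = sym (lookup-index (∈-toList⁻ (∈-resp-↭ (↭-sym σ) (∈-allFin i))))
    injective : ∀ {k} (x : Vec (Fin n) k) → Unique (Vec.toList x) → ∀ i j → Vec.lookup x i ≡ Vec.lookup x j → i ≡ j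
    injective (y Vec.∷ x) (y∉ ∷ uniq) Fin.zero    Fin.zero    eq = refl
    injective (y Vec.∷ x) (y∉ ∷ uniq) Fin.zero    (Fin.suc j) eq = ⊥-elim (All.lookup y∉ (∈-toList⁺ (∈-lookup j x)) eq)
    injective (y Vec.∷ x) (y∉ ∷ uniq) (Fin.suc i) Fin.zero    eq = ⊥-elim (All.lookup y∉ (∈-toList⁺ (∈-lookup i x)) (sym eq))
    injective (y Vec.∷ x) (y∉ ∷ uniq) (Fin.suc i) (Fin.suc j) eq = cong Fin.suc (injective x uniq i j eq)
    pos-lookup : ∀ i → pos (Vec.lookup w i) ≡ i
    pos-lookup i = injective w (Unique-resp-↭ (↭-sym σ) (allFin⁺ n)) _ _ (lookup-pos (Vec.lookup w i))

  -- The common shape of the exceptional graphs: `H` is edgeless in one family and complete in the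
  -- other, and `ij` will be the deleted edge.
  join≅ : ∀ {X R i j} {H : Graph (length R)} → allFin n ↭ X ++ i ∷ j ∷ R →
    AllPairs (λ x y → adj G x y ≡ true) X → All (λ x → All (λ y → adj G x y ≡ true) (i ∷ j ∷ R)) X →
    adj G i j ≡ true → All (λ r → adj G i r ≡ false) R → All (λ r → adj G j r ≡ false) R →
    Realizes H (Vec.fromList R) → G ≅ (complete (length X) ∨ᴳ (complete 2 ∪ᴳ H))
  join≅ {X} {R} {i} {j} σ cX XR ij iR jR rH =
    realizes⇒≅ {H = complete (length X) ∨ᴳ (complete 2 ∪ᴳ _)} w (trans (↭-reflexive w≡) (↭-sym σ))
      (sumGraph-realizes {x = Vec.fromList X} {y = Vec.fromList (i ∷ j ∷ R)} true (λ k l → lookup-All (lookup-All XR k) l) (complete-realizes cX)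
        (sumGraph-realizes {x = Vec.fromList (i ∷ j ∷ [])} {y = Vec.fromList R} false cross (complete-realizes ((ij ∷ []) ∷ [] ∷ [])) rH))
    where
    w = Vec.fromList X Vec.++ Vec.fromList (i ∷ j ∷ R)
    w≡ : Vec.toList w ≡ X ++ i ∷ j ∷ R
    w≡ = ≡.trans (toList-++ (Vec.fromList X) (Vec.fromList (i ∷ j ∷ R)))
           (cong₂ _++_ (toList∘fromList X) (toList∘fromList (i ∷ j ∷ R)))
    cross : ∀ k l → adj G (Vec.lookup (Vec.fromList (i ∷ j ∷ [])) k) (Vec.lookup (Vec.fromList R) l) ≡ false
    cross Fin.zero           l = lookup-All iR l
    cross (Fin.suc Fin.zero) l = lookup-All jR l

pick : ∀ {X : Set} {x : X} {L} → x ∈ L → ∃ λ R → L ↭ x ∷ R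
pick x∈ with extract x∈
... | _ , R , σ , refl = R , σ

pick₂ : ∀ {X : Set} {x y : X} {L} → x ≢ y → x ∈ L → y ∈ L → ∃ λ R → L ↭ x ∷ y ∷ R
pick₂ x≢y x∈ y∈ with pick x∈
... | R , σ with ∈-resp-↭ σ y∈
... | here y≡x = ⊥-elim (x≢y (sym y≡x))
... | there y∈R with pick y∈R
... | R′ , τ = R′ , trans σ (prep _ τ)

-- Supplies the starting point for `near-perfect`; any pairing will do, so consecutive entries are
-- paired.
pairing : ∀ {V : Set} A A-sym k (L : List V) → length L ≡ 2 * k →
          ∃ λ M → Matchings.flat {V} A A-sym M ≡ L × length M ≡ k
pairing A A-sym zero    []          eq = [] , refl , refl
pairing A A-sym (suc k) (x ∷ [])    eq with () ← ≡.trans eq (cong suc (+-suc k (k + 0)))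
pairing A A-sym (suc k) (x ∷ y ∷ L) eq with pairing A A-sym k L (suc-injective (suc-injective (≡.trans eq (cong suc (+-suc k (k + 0))))))
... | M , flat≡ , len = (x , y) ∷ M , cong (λ R → x ∷ y ∷ R) flat≡ , cong suc len

-- Deleting the edge `uv`.

module Deletion {n : ℕ} (G : Graph n) (u v : Fin n) (uv : adj G u v ≡ true) where

  hit : Fin n → Fin n → Bool
  hit i j = (does (i Fin.≟ u) ∧ does (j Fin.≟ v)) ∨ (does (i Fin.≟ v) ∧ does (j Fin.≟ u))

  hit-sym : ∀ i j → hit i j ≡ hit j i
  hit-sym i j = ≡.trans (∨-comm (does (i Fin.≟ u) ∧ does (j Fin.≟ v)) _)
    (cong₂ _∨_ (∧-comm (does (i Fin.≟ v)) _) (∧-comm (does (i Fin.≟ u)) _))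

  G′ : Graph n
  G′ = record
    { adj     = λ i j → adj G i j ∧ not (hit i j)
    ; adj-sym = λ i j → cong₂ (λ x y → x ∧ not y) (adj-sym G i j) (hit-sym i j)
    ; adj-irr = λ i → cong (_∧ not (hit i i)) (adj-irr G i) }

  open Matchings (adj G′) (adj-sym G′) public

  gap₀ : Fin n → Fin n → ℕ
  gap₀ = Matchings.gap (adj G) (adj-sym G)

  missing₀ : List (Fin n) → ℕ
  missing₀ = Matchings.missing (adj G) (adj-sym G)

  deg₀ : Fin n → List (Fin n) → ℕ
  deg₀ = Matchings.deg (adj G) (adj-sym G)

  L : List (Fin n)
  L = allFin n

  Off : Fin n → Set
  Off r = r ≢ u × r ≢ v

  adj′⇒adj : ∀ {i j} → adj G′ i j ≡ true → adj G i j ≡ true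
  adj′⇒adj eq = proj₁ (∧-true eq)

  hit-uv : hit u v ≡ true
  hit-uv rewrite dec-true (u Fin.≟ u) refl | dec-true (v Fin.≟ v) refl = refl

  adj′-uv : adj G′ u v ≡ false
  adj′-uv rewrite hit-uv = ∧-zeroʳ (adj G u v)

  offˡ : ∀ {i} → Off i → ∀ j → adj G′ i j ≡ adj G i j
  offˡ {i} (i≢u , i≢v) j rewrite dec-false (i Fin.≟ u) i≢u | dec-false (i Fin.≟ v) i≢v = ∧-identityʳ (adj G i j)

  offʳ : ∀ {j} → Off j → ∀ i → adj G′ i j ≡ adj G i j
  offʳ {j} off i = ≡.trans (adj-sym G′ i j) (≡.trans (offˡ off i) (adj-sym G j i))

  u≢v : u ≢ v
  u≢v refl = true≢false (≡.trans (sym uv) (adj-irr G u))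

  Ends : Fin n → Fin n → Set
  Ends i j = (i ≡ u × j ≡ v) ⊎ (i ≡ v × j ≡ u)

  Ends-adj : ∀ {i j} → Ends i j → adj G i j ≡ true
  Ends-adj (inj₁ (refl , refl)) = uv
  Ends-adj (inj₂ (refl , refl)) = ≡.trans (adj-sym G v u) uv

  rest-off : ∀ X {i j R} → L ↭ X ++ i ∷ j ∷ R → Ends i j → All Off R
  rest-off X {i} {j} {R} σ ends
    with (_ ∷ i∉) ∷ j∉ ∷ _ ← Unique-resp-↭ (trans σ (++-comm X (i ∷ j ∷ R))) (allFin⁺ n) =
    AllP.++⁻ˡ R (All.zipWith (both ends) (i∉ , j∉))
    where
    both : Ends i j → ∀ {r} → i ≢ r × j ≢ r → Off r
    both (inj₁ (refl , refl)) (i≢r , j≢r) = i≢r ∘ sym , j≢r ∘ sym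
    both (inj₂ (refl , refl)) (i≢r , j≢r) = j≢r ∘ sym , i≢r ∘ sym

  split : ∃ λ R → L ↭ u ∷ v ∷ R
  split = pick₂ u≢v (∈-allFin u) (∈-allFin v)

  R₀ : List (Fin n)
  R₀ = proj₁ split

  off₀ : All Off R₀
  off₀ = rest-off [] (proj₂ split) (inj₁ (refl , refl))

  missing-off : ∀ {R} → All Off R → missing R ≡ missing₀ R
  missing-off []         = refl
  missing-off {r ∷ R} (off ∷ offs) = cong₂ _+_ (∑-ext (λ j → cong (λ b → ind (not b)) (offˡ off j)) R) (missing-off offs)

  gaps-off : ∀ i {R} → All Off R → ∑ (gap i) R ≡ ∑ (gap₀ i) R
  gaps-off i offs = ∑-cong (All.map (λ off → cong (λ b → ind (not b)) (offʳ off i)) offs)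

  missing-suc : missing L ≡ suc (missing₀ L)
  missing-suc = begin
    missing L
      ≡⟨ missing-↭ (proj₂ split) ⟩
    gap u v + ∑ (gap u) R₀ + (∑ (gap v) R₀ + missing R₀)
      ≡⟨ cong₂ _+_ (cong₂ _+_ (cong (λ b → ind (not b)) adj′-uv) (gaps-off u off₀)) (cong₂ _+_ (gaps-off v off₀) (missing-off off₀)) ⟩
    suc (∑ (gap₀ u) R₀ + (∑ (gap₀ v) R₀ + missing₀ R₀))
      ≡⟨ cong (λ b → suc (ind (not b) + ∑ (gap₀ u) R₀ + (∑ (gap₀ v) R₀ + missing₀ R₀))) uv ⟨
    suc (missing₀ (u ∷ v ∷ R₀))
      ≡⟨ cong suc (Matchings.missing-↭ (adj G) (adj-sym G) (proj₂ split)) ⟨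
    suc (missing₀ L) ∎
    where open ≡-Reasoning

  deg-end : ∀ {i} → i ≡ u ⊎ i ≡ v → deg₀ i (u ∷ v ∷ R₀) ≤ suc (deg i (u ∷ v ∷ R₀))
  deg-end {i} end = begin
    ind (adj G i u) + (ind (adj G i v) + deg₀ i R₀)
      ≤⟨ at-most-one end ⟩
    suc (deg₀ i R₀)
      ≡⟨ cong suc (∑-cong (All.map (λ off → cong ind (offʳ off i)) off₀)) ⟨
    suc (deg i R₀)
      ≤⟨ s≤s (≤-trans (m≤n+m (deg i R₀) (ind (adj G′ i v))) (m≤n+m _ (ind (adj G′ i u)))) ⟩
    suc (deg i (u ∷ v ∷ R₀)) ∎
    where
    open ≤-Reasoning
    at-most-one : i ≡ u ⊎ i ≡ v → ind (adj G i u) + (ind (adj G i v) + deg₀ i R₀) ≤ suc (deg₀ i R₀)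
    at-most-one (inj₁ refl) rewrite adj-irr G u = +-monoˡ-≤ (deg₀ u R₀) (ind≤1 (adj G u v))
    at-most-one (inj₂ refl) rewrite adj-irr G v = +-monoˡ-≤ (deg₀ v R₀) (ind≤1 (adj G v u))

  module _ (δ : MinDegreeAtLeast 2 G) where

    2≤deg₀ : ∀ i → 2 ≤ deg₀ i L
    2≤deg₀ i = subst (2 ≤_) (degree≡deg G i) (δ i)

    -- A vertex off `uv` keeps all its neighbours, of which there are at least two.
    end : ∀ i → deg i L ≤ 1 → i ≡ u ⊎ i ≡ v
    end i le = by-cases (i Fin.≟ u) (i Fin.≟ v)
      where
      by-cases : Dec (i ≡ u) → Dec (i ≡ v) → i ≡ u ⊎ i ≡ v
      by-cases (yes i≡u) _         = inj₁ i≡u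
      by-cases (no _)    (yes i≡v) = inj₂ i≡v
      by-cases (no i≢u)  (no i≢v)  = ⊥-elim (n≮n 1 (≤-trans (2≤deg₀ i)
        (≤-trans (≤-reflexive (∑-ext (λ j → cong ind (sym (offˡ (i≢u , i≢v) j))) L)) le)))

    1≤deg : ∀ i → deg i L ≤ 1 → 1 ≤ deg i L
    1≤deg i le = ≤-pred (begin
      2                         ≤⟨ 2≤deg₀ i ⟩
      deg₀ i L                  ≡⟨ ∑-↭ (λ j → ind (adj G i j)) (proj₂ split) ⟩
      deg₀ i (u ∷ v ∷ R₀)       ≤⟨ deg-end (end i le) ⟩
      suc (deg i (u ∷ v ∷ R₀))  ≡⟨ cong suc (∑-↭ (λ j → ind (adj G′ i j)) (proj₂ split)) ⟨
      suc (deg i L)             ∎)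
      where open ≤-Reasoning

    ends : ∀ i j → i ≢ j → deg i L ≤ 1 → deg j L ≤ 1 → Ends i j
    ends i j i≢j di dj with end i di | end j dj
    ... | inj₁ refl | inj₂ refl = inj₁ (refl , refl)
    ... | inj₂ refl | inj₁ refl = inj₂ (refl , refl)
    ... | inj₁ refl | inj₁ refl = ⊥-elim (i≢j refl)
    ... | inj₂ refl | inj₂ refl = ⊥-elim (i≢j refl)

  join′≅ : ∀ {X R i j} {H : Graph (length R)} → L ↭ X ++ i ∷ j ∷ R → Ends i j →
    AllPairs (λ x y → adj G′ x y ≡ true) X → All (λ x → All (λ y → adj G′ x y ≡ true) (i ∷ j ∷ R)) X →
    All (λ r → adj G′ i r ≡ false) R → All (λ r → adj G′ j r ≡ false) R →
    Realizes G H (Vec.fromList R) → G ≅ (complete (length X) ∨ᴳ (complete 2 ∪ᴳ H))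
  join′≅ {X} {R} σ ends cX XR iR jR rH =
    join≅ G σ (AllPairs-map adj′⇒adj cX) (All.map (All.map adj′⇒adj) XR) (Ends-adj ends) (none iR) (none jR) rH
    where
    none : ∀ {i} → All (λ r → adj G′ i r ≡ false) R → All (λ r → adj G i r ≡ false) R
    none {i} h = All.zipWith (λ (off , eq) → ≡.trans (sym (offʳ off i)) eq) (rest-off X σ ends , h)

-- Recognising the exceptional graphs.

-- The sharper bounds for n = 6 and n = 8 just exclude the pendant case: it would need 7 non-edges
-- where 6 are allowed, and 11 where 10 are allowed.
sparse-pendant : ∀ {m μ} → Sparse (suc m) μ → 3 + 4 * m ≤ μ → 4 ≤ suc m
sparse-pendant (small₂ le)    le′ = ⊥-elim (n≮n 6 (≤-trans le′ le))
sparse-pendant (small₃ le)    le′ = ⊥-elim (n≮n 10 (≤-trans le′ le))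
sparse-pendant (large 4≤m le) le′ = 4≤m

module Exceptions {n : ℕ} (G : Graph n) (u v : Fin n) (uv : adj G u v ≡ true)
                  (δ : MinDegreeAtLeast 2 G) where
  open Deletion G u v uv
  open Augment (adj G′) (adj-sym G′) using (stuck₀)
  open Extremal (adj G′) (adj-sym G′)
  open NearPerfect (adj G′) (adj-sym G′) using (NearPerfect; near-perfect)

  None-Adj-off : ∀ {R} → All Off R → None-Adj R → AllPairs (λ x y → adj G x y ≡ false) R
  None-Adj-off []           []       = []
  None-Adj-off (off ∷ offs) (e ∷ es) = All.map (λ {j} eq → ≡.trans (sym (offˡ off j)) eq) e ∷ None-Adj-off offs es

  ¬adj′-uv : adj G′ u v ≡ true → ⊥
  ¬adj′-uv eq = true≢false (≡.trans (sym eq) adj′-uv)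

  -- Any pair meeting `X` is adjacent after the deletion, but `u` and `v` are not; hence both lie in
  -- `I`, and restoring `uv` there produces the `complete 2`.
  independent⇒≅ : ∀ {X I m} → L ↭ X ++ I → length X ≡ m → length I ≡ 2 + m → All-Adj X → Joined X I → None-Adj I →
                  G ≅ (complete m ∨ᴳ (complete 2 ∪ᴳ edgeless m))
  independent⇒≅ {X} {I} {m} σ lenX lenI cX XI nI =
    locate (∈-++⁻ X (∈-resp-↭ σ (∈-allFin u))) (∈-++⁻ X (∈-resp-↭ σ (∈-allFin v)))
    where
    Target = G ≅ (complete m ∨ᴳ (complete 2 ∪ᴳ edgeless m))
    adj-trans-sym : Symmetric (λ x y → adj G′ x y ≡ true)
    adj-trans-sym {x} {y} eq = ≡.trans (adj-sym G′ y x) eq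
    build : ∀ {R} → I ↭ u ∷ v ∷ R → Target
    build {R} τ with (_ ∷ uR) ∷ vR ∷ nR ← AllPairs-resp-↭ (λ {x} {y} eq → ≡.trans (adj-sym G′ y x) eq) τ nI =
      subst₂ (λ r s → G ≅ (complete r ∨ᴳ (complete 2 ∪ᴳ edgeless s))) lenX
        (suc-injective (suc-injective (≡.trans (sym (↭-length τ)) lenI)))
        (join′≅ {X} {R} {H = edgeless (length R)} σ′ (inj₁ (refl , refl)) cX (All.map (All-resp-↭ τ) XI) uR vR
          (edgeless-realizes G (None-Adj-off (rest-off X σ′ (inj₁ (refl , refl))) nR)))
      where
      σ′ : L ↭ X ++ u ∷ v ∷ R
      σ′ = trans σ (++⁺ˡ X τ)
    locate : u ∈ X ⊎ u ∈ I → v ∈ X ⊎ v ∈ I → Target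
    locate (inj₂ u∈) (inj₂ v∈) = build (proj₂ (pick₂ u≢v u∈ v∈))
    locate (inj₁ u∈) (inj₂ v∈) = ⊥-elim (¬adj′-uv (All.lookup (All.lookup XI u∈) v∈))
    locate (inj₂ u∈) (inj₁ v∈) = ⊥-elim (¬adj′-uv (adj-trans-sym (All.lookup (All.lookup XI v∈) u∈)))
    locate (inj₁ u∈) (inj₁ v∈) with pick₂ u≢v u∈ v∈
    ... | R , τ with (eq ∷ _) ∷ _ ← AllPairs-resp-↭ adj-trans-sym τ cX = ⊥-elim (¬adj′-uv eq)

  neighbour : ∀ b N → All Edge N → 1 ≤ deg b (flat N) →
    ∃₂ λ x y → ∃ λ N′ → flat N ↭ x ∷ y ∷ flat N′ × adj G′ b x ≡ true × All Edge N′ × length N ≡ suc (length N′)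
  neighbour b N es le with extract (∑-pos (λ e → ind (adj G′ b (proj₁ e)) + ind (adj G′ b (proj₂ e))) N
                                     (subst (1 ≤_) (∑-flat (λ x → ind (adj G′ b x)) N) le))
  ... | (x , y) , N′ , σ , le′ with adj G′ b x in bx | adj G′ b y in by
  ... | true  | _    = x , y , N′ , flat-↭ σ , bx , All.tail (All-resp-↭ σ es) , ↭-length σ
  ... | false | true = y , x , N′ , trans (flat-↭ σ) (swap x y refl) , by , All.tail (All-resp-↭ σ es) , ↭-length σ

  -- Let `x` be the only neighbour of `b`, `y` its partner, and m + 1 the number of edges in `N`.
  -- Then `b` has 2 + 2m non-neighbours and the graph without `b` and `x` has at least 1 + 2m
  -- non-edges, which together exhaust the edge bound. So `x` is adjacent to all, and `stuck-tight`
  -- yields a vertex `w` isolated in the rest, which is otherwise a clique. Both `b` and `w` have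
  -- degree at most 1, so they are the ends of the deleted edge.
  pendant⇒≅ : ∀ {a b N} → flat ((a , b) ∷ N) ↭ L → Stuck (a , b) N → All Edge N → deg b (flat N) ≤ 1 →
              Sparse (length N) (missing L) →
              4 ≤ length N × G ≅ (complete 1 ∨ᴳ (complete 2 ∪ᴳ complete (n ∸ 3)))
  pendant⇒≅ {a} {b} {N} σ st es d≤1 sp = build (neighbour b N es (subst (1 ≤_) degb (1≤deg δ b db≤1)))
    where
    ba : adj G′ b a ≡ false
    ba = ≡.trans (adj-sym G′ b a) (stuck₀ (Stuck-prefix [] es st))
    degb : deg b L ≡ deg b (flat N)
    degb = ≡.trans (∑-↭ (λ j → ind (adj G′ b j)) (↭-sym σ))
             (cong₂ (λ x y → ind x + (ind y + deg b (flat N))) ba (adj-irr G′ b))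
    db≤1 : deg b L ≤ 1
    db≤1 = subst (_≤ 1) (sym degb) d≤1
    build : (∃₂ λ x y → ∃ λ N′ → flat N ↭ x ∷ y ∷ flat N′ × adj G′ b x ≡ true × All Edge N′ × length N ≡ suc (length N′)) →
            4 ≤ length N × G ≅ (complete 1 ∨ᴳ (complete 2 ∪ᴳ complete (n ∸ 3)))
    build (x , y , N′ , τ , bx , es′ , len) =
      4≤N , finish (stuck-tight a y N′ es′ st′ (≤-trans (s≤s (s≤s z≤n)) (≤-pred (subst (4 ≤_) len 4≤N))) (proj₂ tight))
      where
      m = length N′
      K₀ = flat ((a , y) ∷ N′)
      ρ′ : a ∷ b ∷ x ∷ y ∷ flat N′ ↭ b ∷ x ∷ K₀
      ρ′ = trans (swap a b refl) (prep b (swap a x refl))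
      ρ : L ↭ b ∷ x ∷ K₀
      ρ = trans (↭-sym σ) (trans (prep a (prep b τ)) ρ′)
      -- A perfect matching of the rest could be completed by `bx`.
      st′ : Stuck (a , y) N′
      st′ (M , θ , edges) = st ((b , x) ∷ M , trans (prep b (prep x θ)) (trans (↭-sym ρ′) (prep a (prep b (↭-sym τ)))) , bx ∷ edges)
      bK₀≡0 : deg b K₀ ≡ 0
      bK₀≡0 = n≤0⇒n≡0 (≤-pred (≤-trans (≤-reflexive (sym (≡.trans (∑-↭ (λ j → ind (adj G′ b j)) ρ)
        (cong₂ (λ i j → ind i + (ind j + deg b K₀)) (adj-irr G′ b) bx)))) db≤1))
      missing-L : missing L ≡ 2 + 2 * m + (∑ (gap x) K₀ + missing K₀)
      missing-L = ≡.trans (missing-↭ ρ) (cong (_+ (∑ (gap x) K₀ + missing K₀))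
        (≡.trans (cong (λ i → ind (not i) + ∑ (gap b) K₀) bx)
          (≡.trans (all-gaps (deg≡0 K₀ bK₀≡0)) (cong (2 +_) (flat-length N′)))))
      lower : 1 + 2 * m ≤ missing K₀
      lower = stuck-missing a y N′ es′ st′
      4≤N : 4 ≤ length N
      4≤N = subst (4 ≤_) (sym len) (sparse-pendant (subst (λ k → Sparse k (missing L)) len sp) (begin
        3 + 4 * m                                          ≡⟨ rearrange m ⟩
        2 + 2 * m + (0 + (1 + 2 * m))                      ≤⟨ +-monoʳ-≤ (2 + 2 * m) (+-mono-≤ (z≤n {∑ (gap x) K₀}) lower) ⟩
        2 + 2 * m + (∑ (gap x) K₀ + missing K₀)            ≡⟨ missing-L ⟨
        missing L                                          ∎))
        where
        open ≤-Reasoning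
        rearrange : ∀ m → 3 + 4 * m ≡ 2 + 2 * m + (0 + (1 + 2 * m))
        rearrange = solve-∀
      upper≤ : ∑ (gap x) K₀ + missing K₀ ≤ 1 + 2 * m
      upper≤ = ≤-by 0 (subst (λ k → suc (missing L) ≤ 4 * k) len (sparse-strict sp))
        (≡.trans (rearrange m (∑ (gap x) K₀ + missing K₀)) (cong (λ μ → suc μ + (1 + 2 * m)) (sym missing-L)))
        where
        rearrange : ∀ m s → s + 4 * suc m + 0 ≡ suc (2 + 2 * m + s) + (1 + 2 * m)
        rearrange = solve-∀
      tight : ∑ (gap x) K₀ ≡ 0 × missing K₀ ≤ 1 + 2 * m
      tight = n≤0⇒n≡0 (+-cancelʳ-≤ (1 + 2 * m) (∑ (gap x) K₀) 0 (≤-trans (+-monoʳ-≤ (∑ (gap x) K₀) lower) upper≤)) ,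
              ≤-trans (m≤n+m (missing K₀) (∑ (gap x) K₀)) upper≤
      finish : (∃₂ λ w K → K₀ ↭ w ∷ K × deg w K ≡ 0 × missing K ≡ 0) → G ≅ (complete 1 ∨ᴳ (complete 2 ∪ᴳ complete (n ∸ 3)))
      finish (w , K , θ , wK≡0 , K≡0) =
        subst (λ k → G ≅ (complete 1 ∨ᴳ (complete 2 ∪ᴳ complete k))) lenK
          (join′≅ {x ∷ []} {K} {b} {w} {complete (length K)} κ (ends δ b w b≢w db≤1 dw≤1) ([] ∷ [])
            ((≡.trans (adj-sym G′ x b) bx ∷ All-resp-↭ θ (gaps≡0 K₀ (proj₁ tight))) ∷ []) (All.tail bwK) (deg≡0 K wK≡0)
            (complete-realizes G (AllPairs-map adj′⇒adj (missing≡0 K K≡0))))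
        where
        bwK : All (λ z → adj G′ b z ≡ false) (w ∷ K)
        bwK = All-resp-↭ θ (deg≡0 K₀ bK₀≡0)
        κ : L ↭ x ∷ b ∷ w ∷ K
        κ = trans ρ (trans (swap b x refl) (prep x (prep b θ)))
        lenK : length K ≡ n ∸ 3
        lenK = cong (_∸ 3) (≡.trans (sym (↭-length κ)) (length-allFin n))
        b≢w : b ≢ w
        b≢w = second≢third (Unique-resp-↭ κ (allFin⁺ n))
          where
          second≢third : Unique (x ∷ b ∷ w ∷ K) → b ≢ w
          second≢third (_ ∷ (b≢w ∷ _) ∷ _) = b≢w
        dw≤1 : deg w L ≤ 1
        dw≤1 = begin
          deg w L
            ≡⟨ ∑-↭ (λ j → ind (adj G′ w j)) κ ⟩
          ind (adj G′ w x) + (ind (adj G′ w b) + (ind (adj G′ w w) + deg w K))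
            ≡⟨ cong₂ (λ i j → ind (adj G′ w x) + (ind i + j)) (≡.trans (adj-sym G′ w b) (All.head bwK))
                     (cong₂ (λ i j → ind i + j) (adj-irr G′ w) wK≡0) ⟩
          ind (adj G′ w x) + 0
            ≤⟨ +-monoˡ-≤ 0 (ind≤1 (adj G′ w x)) ⟩
          1 ∎
          where open ≤-Reasoning

  -- The bounds on `m` tell which exceptions occur for which n = 2m + 2; both remain possible at n =
  -- 10.
  Exceptional : ℕ → Set
  Exceptional m = (m ≤ 4 × G ≅ (complete m ∨ᴳ (complete 2 ∪ᴳ edgeless m)))
                ⊎ (4 ≤ m × G ≅ (complete 1 ∨ᴳ (complete 2 ∪ᴳ complete (n ∸ 3))))

  near-perfect⇒exceptional : ∀ {m a b N} → flat ((a , b) ∷ N) ↭ L → All Edge N → length N ≡ m →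
    Sparse m (missing L) → ¬ PerfectMatching G′ → Exceptional m
  near-perfect⇒exceptional {a = a} {b} {N} σ es refl sp ¬pm = by-degrees (deg a (flat N) ≤? 1) (deg b (flat N) ≤? 1)
    where
    st : Stuck (a , b) N
    st mt = ¬pm (Matchable⇒PerfectMatching G′ (Matchable-↭ σ mt))
    join-case : (∃₂ λ X I → flat ((a , b) ∷ N) ↭ X ++ I × length X ≡ length N × length I ≡ 2 + length N ×
                   All-Adj X × Joined X I × None-Adj I × length N ≤ 4) → Exceptional (length N)
    join-case (X , I , τ , lenX , lenI , cX , XI , nI , m≤4) =
      inj₁ (m≤4 , independent⇒≅ (trans (↭-sym σ) τ) lenX lenI cX XI nI)
    by-degrees : Dec (deg a (flat N) ≤ 1) → Dec (deg b (flat N) ≤ 1) → Exceptional (length N)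
    by-degrees _        (yes db) = inj₂ (pendant⇒≅ σ st es db sp)
    by-degrees (yes da) (no _)   = inj₂ (pendant⇒≅ (trans (swap b a refl) σ) (Stuck-flip st) es da sp)
    by-degrees (no ¬da) (no ¬db) = join-case
      (independent-join a b N es st (≰⇒> ¬da) (≰⇒> ¬db) (subst (Sparse (length N)) (sym (missing-↭ σ)) sp))

  exceptional : ∀ m → n ≡ 2 * suc m → Sparse m (missing L) → ¬ PerfectMatching G′ → Exceptional m
  exceptional m n≡ sp ¬pm = start (pairing (adj G′) (adj-sym G′) (suc m) L (≡.trans (length-allFin n) n≡))
    where
    start : (∃ λ M → flat M ≡ L × length M ≡ suc m) → Exceptional m
    start (M , flat≡L , len) = continue (near-perfect (∑ gap′ M) M ≤-refl
      (λ mt → ¬pm (Matchable⇒PerfectMatching G′ (subst Matchable flat≡L mt)))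
      -- There are m + 1 pairs, so adding 4 to both sides of `sparse-strict` gives the required
      -- bound.
      (subst₂ (λ R k → 5 + missing R ≤ 4 * k) (sym flat≡L) (sym len)
        (≤-trans (+-monoʳ-≤ 4 (sparse-strict sp)) (≤-reflexive (sym (*-suc 4 m))))))
      where
      continue : NearPerfect M → Exceptional m
      continue ((a , b) , N , σ , es , len′) =
        near-perfect⇒exceptional (trans σ (↭-reflexive flat≡L)) es (suc-injective (≡.trans len′ len)) sp ¬pm

-- From the edge-deleted graph back to the theorem.

avoiding : ∀ {n} (G : Graph n) u v uv → PerfectMatching (Deletion.G′ G u v uv) → Σ (PerfectMatching G) λ M → partner M u ≢ v
avoiding G u v uv M = record
  { partner = partner M ; partner-edge = λ i → adj′⇒adj (partner-edge M i) ; partner-invol = partner-invol M } ,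
  λ eq → true≢false (≡.trans (sym (partner-edge M u)) (≡.trans (cong (adj G′ u) eq) adj′-uv))
  where open Deletion G u v uv

-- The `suc` in the `Sparse` hypothesis is the non-edge created by deleting `uv`.
excludable : ∀ {n} (G : Graph n) m → n ≡ 2 * suc m → MinDegreeAtLeast 2 G →
  Sparse m (suc (Matchings.missing (adj G) (adj-sym G) (allFin n))) →
  ¬ (m ≤ 4 × G ≅ (complete m ∨ᴳ (complete 2 ∪ᴳ edgeless m))) →
  ¬ (4 ≤ m × G ≅ (complete 1 ∨ᴳ (complete 2 ∪ᴳ complete (n ∸ 3)))) → OneExcludable G
excludable G m n≡ δ sp ¬exc ¬exc′ u v uv with perfectMatching? (Deletion.G′ G u v uv)
... | yes M  = avoiding G u v uv M
... | no ¬pm with Exceptions.exceptional G u v uv δ m n≡ (subst (Sparse m) (sym (Deletion.missing-suc G u v uv)) sp) ¬pm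
... | inj₁ exc  = ⊥-elim (¬exc exc)
... | inj₂ exc′ = ⊥-elim (¬exc′ exc′)

missing≤ : ∀ {n} (G : Graph n) {e s} → e ≤ numEdges G → e + s ≡ tri n →
           Matchings.missing (adj G) (adj-sym G) (allFin n) ≤ s
missing≤ {n} G {e} {s} le eq = +-cancelˡ-≤ e _ s (≤-trans (+-monoˡ-≤ _ le)
  (≤-reflexive (≡.trans (numEdges+missing G) (sym eq))))

theorem1p3 : ∀ (n : ℕ) (G : Graph n) →
    Σ ℕ (λ k → n ≡ 2 * k) → 0 < n → Connected G → MinDegreeAtLeast 2 G →
    ((n ≡ 6 → 10 ≤ numEdges G →
    ¬ (G ≅ (complete 2 ∨ᴳ (complete 2 ∪ᴳ edgeless 2))) → OneExcludable G)
    × (n ≡ 8 → 19 ≤ numEdges G →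
    ¬ (G ≅ (complete 3 ∨ᴳ (complete 2 ∪ᴳ edgeless 3))) → OneExcludable G)
    × (10 ≤ n → ((n ∸ 2) C 2) + 3 ≤ numEdges G →
    ¬ (G ≅ (complete 4 ∨ᴳ (complete 2 ∪ᴳ edgeless 4))) →
    ¬ (G ≅ (complete 1 ∨ᴳ (complete 2 ∪ᴳ complete (n ∸ 3)))) → OneExcludable G))
theorem1p3 n G (k , n≡2k) _ _ δ = six , eight , large-case k n≡2k
  where
  six : n ≡ 6 → 10 ≤ numEdges G → ¬ (G ≅ (complete 2 ∨ᴳ (complete 2 ∪ᴳ edgeless 2))) → OneExcludable G
  -- Of 15 pairs at most 5 are non-edges, and the deletion makes it 6.
  six refl le ¬exc = excludable G 2 refl δ (small₂ (s≤s (missing≤ G {10} {5} le refl)))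
    (¬exc ∘ proj₂) (λ { (s≤s (s≤s ()) , _) })
  eight : n ≡ 8 → 19 ≤ numEdges G → ¬ (G ≅ (complete 3 ∨ᴳ (complete 2 ∪ᴳ edgeless 3))) → OneExcludable G
  -- Of 28 pairs at most 9 are non-edges, and the deletion makes it 10.
  eight refl le ¬exc = excludable G 3 refl δ (small₃ (s≤s (missing≤ G {19} {9} le refl)))
    (¬exc ∘ proj₂) (λ { (s≤s (s≤s (s≤s ())) , _) })
  large-case : ∀ k → n ≡ 2 * k → 10 ≤ n → ((n ∸ 2) C 2) + 3 ≤ numEdges G →
    ¬ (G ≅ (complete 4 ∨ᴳ (complete 2 ∪ᴳ edgeless 4))) →
    ¬ (G ≅ (complete 1 ∨ᴳ (complete 2 ∪ᴳ complete (n ∸ 3)))) → OneExcludable G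
  large-case zero    n≡0  10≤n = ⊥-elim (n≮0 (subst (10 ≤_) n≡0 10≤n))
  large-case (suc m) n≡2k 10≤n le ¬exc ¬exc′ = excludable G m n≡2k δ (large 4≤m few)
    -- Together with `4≤m` this exception is pinned to m = 4, that is n = 10.
    (λ (m≤4 , iso) → ¬exc (subst (λ r → G ≅ (complete r ∨ᴳ (complete 2 ∪ᴳ edgeless r))) (≤-antisym m≤4 4≤m) iso))
    (¬exc′ ∘ proj₂)
    where
    n≡ : n ≡ 2 + 2 * m
    n≡ = ≡.trans n≡2k (*-suc 2 m)
    4≤m : 4 ≤ m
    4≤m = ≤-pred (*-cancelˡ-≤ 2 (subst (10 ≤_) n≡2k 10≤n))
    -- With n = 2m + 2 there are `tri (2 * m)` + 4m + 1 pairs, so the edge bound leaves at most 4m -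
    -- 2 non-edges before the deletion.
    few : suc (suc (Matchings.missing (adj G) (adj-sym G) (allFin n))) ≤ 4 * m
    few = ≤-by 0 (+-monoˡ-≤ (Matchings.missing (adj G) (adj-sym G) (allFin n)) le) (begin
      2 + μ + (numEdges G + μ) + 0      ≡⟨ cong (λ t → 2 + μ + t + 0) (≡.trans (numEdges+missing G) (cong tri n≡)) ⟩
      2 + μ + tri (2 + 2 * m) + 0       ≡⟨ rearrange m μ (tri (2 * m)) ⟩
      tri (2 * m) + 3 + μ + 4 * m       ≡⟨ cong (λ t → t + 3 + μ + 4 * m) (≡.trans (tri≡C₂ (2 * m)) (cong (λ k → (k ∸ 2) C 2) (sym n≡))) ⟩
      (n ∸ 2) C 2 + 3 + μ + 4 * m       ∎)
      where
      open ≡-Reasoning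
      μ = Matchings.missing (adj G) (adj-sym G) (allFin n)
      rearrange : ∀ m μ t → 2 + μ + (1 + 2 * m + (2 * m + t)) + 0 ≡ t + 3 + μ + 4 * m
      rearrange = solve-∀
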